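{- Let $m,n$ be positive integers. For $\pi\in\mathcal{PF}_{m,n}$ with word $\sigma(\pi)=n(n-1)\cdots21$, let $\lambda(\pi)=(\lambda_1,\dots,\lambda_n)$ and let $\mathrm{hstr}(\pi)$ be the unique $(m+n,n)$-parking function with word $12\cdots n$ whose partition is $\lambda(\mathrm{hstr}(\pi))=(\lambda_1+n-1,\lambda_2+n-2,\dots,\lambda_{n-1}+1,\lambda_n)$. Then $\mathrm{hstr}$ is a bijection from $\{\pi\in\mathcal{PF}_{m,n}:\sigma(\pi)=n\cdots21\}$ onto $\{\pi\in\mathcal{PF}_{m+n,n}:\sigma(\pi)=12\cdots n\}$, and for every such $\pi$, $\mathrm{area}(\mathrm{hstr}(\pi))=\mathrm{area}(\pi)$, $\mathrm{dinv}(\mathrm{hstr}(\pi))=\mathrm{dinv}(\pi)$ and $\mathrm{ret}(\mathrm{hstr}(\pi))=\mathrm{ret}(\pi)$.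
   Context: An $(m,n)$-Dyck path is a north/east lattice path from $(0,0)$ to $(m,n)$ weakly above $y=\frac nm x$. An $(m,n)$-parking function $\pi$ is such a path $\Pi(\pi)$ whose $n$ north steps are labeled bijectively by $1,\dots,n$ (cars, in the cells just right of the north steps), increasing upward in each column; $\mathcal{PF}_{m,n}$ is the set. $\lambda(\pi)$ is the partition, in English notation, formed by the cells of the $m\times n$ rectangle above $\Pi(\pi)$ (row $i$ counted from the top; the bottom row always has $0$ such cells). With $d=\gcd(m,n)$, cell $(x,y)$ (lower-left corner) has rank $my-nx+\lfloor xd/m\rfloor$; a car's rank is that of its cell, and the word $\sigma(\pi)$ lists the cars in decreasing order of rank. $\mathrm{area}(\pi)$ = number of full cells between path and diagonal. For $c\in\lambda(P)$, $\mathrm{arm}(c),\mathrm{leg}(c)$ count cells of $\lambda(P)$ to the right of and below $c$; $\mathrm{pdinv}(P)=\#\{c:\frac{\mathrm{arm}(c)}{\mathrm{leg}(c)+1}\le\frac mn<\frac{\mathrm{arm}(c)+1}{\mathrm{leg}(c)}\}$ (with $x/0=\infty$); $\mathrm{tdinv}(\pi)=\#\{\text{cars }i<j:\mathrm{rank}(i)<\mathrm{rank}(j)<\mathrm{rank}(i)+m\}$; $\mathrm{maxdinv}(P)$ is the maximum tdinv over parking functions on $P$; $\mathrm{dinv}(\pi)=\mathrm{tdinv}(\pi)+\mathrm{pdinv}(\Pi(\pi))-\mathrm{maxdinv}(\Pi(\pi))$. With $(m,n)=(km_0,kn_0)$, $\gcd(m_0,n_0)=1$, $\mathrm{ret}(\pi)$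 is the least $i\ge1$ such that $\Pi(\pi)$ passes through $(im_0,in_0)$. -}

module Defs where

open import Data.Nat using (ℕ; zero; suc; _+_; _*_; _∸_; _⊔_; _≤ᵇ_; _<ᵇ_; _≡ᵇ_)
open import Data.Nat.DivMod using (_/_)
open import Data.Nat.GCD using (gcd)
open import Data.Bool using (Bool; true; false; _∧_; _∨_; if_then_else_; not)
open import Data.List using (List; []; _∷_; map; foldr; concatMap)
open import Data.Vec as V using (Vec; []; _∷_)
open import Data.Fin using (Fin; toℕ)
open import Data.Integer as ℤ using (ℤ; +_)
open import Relation.Nullary.Decidable using (⌊_⌋)

allBelow : ℕ → (ℕ → Bool) → Bool
allBelow zero    p = true
allBelow (suc k) p = allBelow k p ∧ p k

count : ℕ → (ℕ → Bool) → ℕ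
count zero    p = 0
count (suc k) p = count k p + (if p k then 1 else 0)

sumBelow : ℕ → (ℕ → ℕ) → ℕ
sumBelow zero    f = 0
sumBelow (suc k) f = sumBelow k f + f k

at : ∀ {k} → Vec ℕ k → ℕ → ℕ → ℕ
at []       i       d = d
at (x ∷ xs) zero    d = x
at (x ∷ xs) (suc i) d = at xs i d

-- floor division, with the (unused) convention a / 0 = 0
fdiv : ℕ → ℕ → ℕ
fdiv a zero    = 0
fdiv a (suc b) = a / suc b

search : ℕ → ℕ → (ℕ → Bool) → ℕ → ℕ
search zero     s p d = d
search (suc f)  s p d = if p s then s else search f (suc s) p d

maximum : List ℕ → ℕ
maximum = foldr _⊔_ 0

filterB : ∀ {A : Set} → (A → Bool) → List A → List A
filterB p []       = []
filterB p (x ∷ xs) = if p x then x ∷ filterB p xs else filterB p xs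

allVecs : (k b : ℕ) → List (Vec ℕ k)
allVecs zero    b = [] ∷ []
allVecs (suc k) b =
  concatMap (λ x → map (x ∷_) (allVecs k b)) (Data.List.upTo b)
  where import Data.List

_<ℤ_ : ℤ → ℤ → Bool
x <ℤ y = ⌊ x ℤ.<? y ⌋

-- Paths and parking functions.
--
-- An (m,n)-Dyck path P is encoded by  a : Vec ℕ n,  where a_y (y < n) is the
-- x-coordinate of the north step from (a_y, y) to (a_y, y+1).  The path is
-- (0,0) →E… (a_0,0) →N (a_0,1) →E… (a_1,1) → … →N (a_{n-1},n) →E… (m,n).
-- Weakly above y = (n/m) x  ⇔  m·y ≥ n·a_y for all y < n.

isPath : (m n : ℕ) → Vec ℕ n → Bool
isPath m n a = allBelow n λ y →
     ((y ≡ᵇ 0) ∨ (at a (y ∸ 1) 0 ≤ᵇ at a y 0))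
   ∧ (at a y 0 ≤ᵇ m)
   ∧ (n * at a y 0 ≤ᵇ m * y)

-- A labelling is encoded by  r : Vec ℕ n,  r_c = row of car c (cars are
-- 0-indexed: car c here is car c+1 of the paper).  Car c sits in the cell
-- (a_{r_c}, r_c) just right of the north step of row r_c.
-- Valid: rows < n, cars in distinct rows (bijective labelling), and
-- increasing upward in each column.
isLabelling : (n : ℕ) → Vec ℕ n → Vec ℕ n → Bool
isLabelling n a r =
    allBelow n (λ c → at r c 0 <ᵇ n)
  ∧ allBelow n (λ c' → allBelow c' λ c →
        not (at r c 0 ≡ᵇ at r c' 0)
      ∧ (not (at a (at r c 0) 0 ≡ᵇ at a (at r c' 0) 0) ∨ (at r c 0 <ᵇ at r c' 0)))

Raw : ℕ → Set
Raw n = Vec ℕ n × Vec ℕ n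
  where open import Data.Product using (_×_)

open import Data.Product using (_×_; _,_; proj₁; proj₂)

isPF : (m n : ℕ) → Raw n → Bool
isPF m n (a , r) = isPath m n a ∧ isLabelling n a r

cellRank : (m n x y : ℕ) → ℤ
cellRank m n x y = (+ (m * y) ℤ.- + (n * x)) ℤ.+ + fdiv (x * gcd m n) m

carRank : (m n : ℕ) → Raw n → ℕ → ℤ
carRank m n (a , r) c = cellRank m n (at a (at r c 0) 0) (at r c 0)

-- position (0-indexed) of car c in σ(π), the list of cars in decreasing
-- order of rank: the number of cars of strictly larger rank
-- (ranks of distinct cars are distinct).
wordPos : (m n : ℕ) → Raw n → ℕ → ℕ
wordPos m n π c = count n λ c' → carRank m n π c <ℤ carRank m n π c'

hasWord : (m n : ℕ) → Raw n → Vec ℕ n → Bool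
hasWord m n π w = allBelow n λ k → (wordPos m n π (at w k 0) ≡ᵇ k)

-- the word n(n-1)⋯21  (0-indexed cars: n-1, …, 1, 0)
decWord : (n : ℕ) → Vec ℕ n
decWord n = V.tabulate λ (k : Fin n) → n ∸ suc (toℕ k)

-- the word 12⋯n  (0-indexed cars: 0, 1, …, n-1)
incWord : (n : ℕ) → Vec ℕ n
incWord n = V.tabulate toℕ

-- The partition λ(P): row i from the top (0-indexed) has λ_i = a_{n-1-i}
-- cells above the path.

lam : ∀ {n} → Vec ℕ n → Vec ℕ n
lam = V.reverse

staircase : ∀ {n} → Vec ℕ n → Vec ℕ n
staircase {n} l = V.zipWith _+_ l (V.tabulate λ (i : Fin n) → n ∸ suc (toℕ i))

-- full cells (x,y) (lower-left corner) between path and diagonal: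
-- right of the path in row y and with lower-right corner (x+1,y) weakly
-- above the diagonal.
area : (m n : ℕ) → Raw n → ℕ
area m n (a , r) = sumBelow n λ y → count m λ x →
  (at a y 0 ≤ᵇ x) ∧ (n * suc x ≤ᵇ m * y)

-- pdinv of a partition l = λ(P) (rows from the top, 0-indexed).
-- cell c = (i,j), j < l_i;  arm = l_i - j - 1;  leg = #{i' > i | j < l_{i'}}.
-- arm/(leg+1) ≤ m/n  ⇔ arm·n ≤ m(leg+1);
-- m/n < (arm+1)/leg (x/0 = ∞)  ⇔ leg = 0 ∨ m·leg < n(arm+1).
pdinvλ : (m n : ℕ) → Vec ℕ n → ℕ
pdinvλ m n l = sumBelow n λ i → count (at l i 0) λ j →
  let arm = at l i 0 ∸ suc j
      leg = count n (λ i' → (i <ᵇ i') ∧ (j <ᵇ at l i' 0))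
  in (arm * n ≤ᵇ m * suc leg) ∧ ((leg ≡ᵇ 0) ∨ (m * leg <ᵇ n * suc arm))

pdinv : (m n : ℕ) → Vec ℕ n → ℕ
pdinv m n a = pdinvλ m n (lam a)

tdinv : (m n : ℕ) → Raw n → ℕ
tdinv m n π = sumBelow n λ j → count j λ i →
  (carRank m n π i <ℤ carRank m n π j)
  ∧ (carRank m n π j <ℤ (carRank m n π i ℤ.+ + m))

maxdinv : (m n : ℕ) → Vec ℕ n → ℕ
maxdinv m n a = maximum (map (λ r → tdinv m n (a , r))
                             (filterB (isLabelling n a) (allVecs n n)))

dinv : (m n : ℕ) → Raw n → ℤ
dinv m n (a , r) =
  (+ tdinv m n (a , r) ℤ.+ + pdinv m n a) ℤ.- + maxdinv m n a

onPath : (m n : ℕ) → Vec ℕ n → ℕ → ℕ → Bool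
onPath m n a X Y =
  (Y ≤ᵇ n) ∧ (lower ≤ᵇ X) ∧ (X ≤ᵇ ext Y)
  where
  ext : ℕ → ℕ
  ext y = if y <ᵇ n then at a y 0 else m
  lower : ℕ
  lower = if (Y ≡ᵇ 0) then 0 else ext (Y ∸ 1)

-- ret: least i ≥ 1 with (i m₀, i n₀) on the path, k = gcd(m,n),
-- m₀ = m/k, n₀ = n/k  (search in 1..k; i = k always works)
ret : (m n : ℕ) → Raw n → ℕ
ret m n (a , r) =
  let k = gcd m n ; m₀ = fdiv m k ; n₀ = fdiv n k
  in search k 1 (λ i → onPath m n a (i * m₀) (i * n₀)) k

inA : (m n : ℕ) → Raw n → Bool
inA m n π = isPF m n π ∧ hasWord m n π (decWord n)

inB : (m n : ℕ) → Raw n → Bool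
inB m n π = isPF m n π ∧ hasWord m n π (incWord n)

{-# OPTIONS --safe #-}
module Submission where

-- Write D_y = m y - n a_y for the height of row y above the diagonal.  Ranks order the rows by D,
-- ties being broken upwards, and hstr sends a_y to a_y + y, which leaves every D_y unchanged when m
-- becomes m + n.  So the order of the rows by rank is the same before and after, and only the labelling
-- is reversed; columns become single cells, so every labelling is admissible afterwards.
--
-- For the word n⋯21 tdinv is maximal and dinv is pdinv; for the word 12⋯n tdinv is 0 and
-- dinv is pdinv - maxdinv, maxdinv being the number of pairs of rows whose ranks differ by less than
-- m + n.  It remains to see that pdinv grows by that number.  The cells in row y with a fixed leg lie
-- over the horizontal run between rows u and u + 1, and pdinv counts those with D in a window of length m + n
-- about D_y.  Passing to (m + n, n) prolongs every run by one cell and the window by n.  The values of D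
-- along a run descend in steps of n, so they meet the new part of the window at most once, and
-- the resulting indicators telescope over u to [-(m + n) ≤ D_y - D_u < m + n].

open import Defs
open import Data.Nat using (ℕ; _+_; _<_)
open import Data.Bool using (T)
open import Data.Product using (Σ; _×_; _,_; proj₁)
open import Relation.Binary.PropositionalEquality using (_≡_)

open import Data.Bool using (Bool; true; false; _∧_; _∨_; not; if_then_else_)
open import Data.Bool.Properties using (T-∧; T-∨; ∧-comm; ∧-identityʳ; ∧-zeroʳ)
open import Data.Empty using (⊥-elim)
open import Data.Fin using (toℕ)
open import Data.Integer as ℤ using () renaming (+_ to pos)
import Data.Integer.Properties as ℤ
open import Data.List.Membership.Propositional using (_∈_; lose)
open import Data.List.Membership.Propositional.Properties using (∈-concatMap⁺; ∈-map⁺; ∈-upTo⁺)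
open import Data.List.Relation.Unary.Any using (here; there)
open import Data.List using ([]; _∷_; map)
open import Data.Nat hiding (ℕ; _+_; _<_)
open import Data.Nat.Divisibility
open import Data.Nat.DivMod
open import Data.Nat.GCD
open import Data.Nat.Properties
open import Data.Nat.Solver using (module +-*-Solver)
open import Data.Product using (∃; proj₂)
open import Data.Sum using (_⊎_; inj₁; inj₂)
open import Data.Unit using (tt)
open import Data.Vec using (Vec; []; _∷_; reverse; tabulate; zipWith; _∷ʳ_)
open import Data.Vec.Properties using (reverse-∷; reverse-injective; reverse-involutive)
open import Function using (_∘_; id)
open import Function.Bundles using (Equivalence)
open import Relation.Binary.Definitions using (tri<; tri≈; tri>)
open import Relation.Binary.PropositionalEquality hiding (_≡_)
open import Relation.Nullary using (¬_; contradiction)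
open import Relation.Nullary.Decidable using (toWitness; fromWitness)

open +-*-Solver using (Polynomial; solve; _:+_; _:*_; _:=_; con)

one : ∀ {k} → Polynomial k
one = con 1

-- Booleans and indicators

T-ext : ∀ {x y} → (T x → T y) → (T y → T x) → x ≡ y
T-ext {true}  {true}  _ _ = refl
T-ext {true}  {false} f _ = ⊥-elim (f tt)
T-ext {false} {true}  _ g = ⊥-elim (g tt)
T-ext {false} {false} _ _ = refl

T-∧⁻ : ∀ {x y} → T (x ∧ y) → T x × T y
T-∧⁻ = Equivalence.to T-∧

T-∧⁺ : ∀ {x y} → T x → T y → T (x ∧ y)
T-∧⁺ p q = Equivalence.from T-∧ (p , q)

T-not⁻ : ∀ {x} → T (not x) → ¬ T x
T-not⁻ {false} _ ()

T-not⁺ : ∀ {x} → ¬ T x → T (not x)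
T-not⁺ {true}  h = h tt
T-not⁺ {false} _ = tt

<ᵇ-cong : ∀ {a b c d} → (a < b → c < d) → (c < d → a < b) → (a <ᵇ b) ≡ (c <ᵇ d)
<ᵇ-cong f g = T-ext (λ t → <⇒<ᵇ (f (<ᵇ⇒< _ _ t))) (λ t → <⇒<ᵇ (g (<ᵇ⇒< _ _ t)))

≤ᵇ-cong : ∀ {a b c d} → (a ≤ b → c ≤ d) → (c ≤ d → a ≤ b) → (a ≤ᵇ b) ≡ (c ≤ᵇ d)
≤ᵇ-cong f g = T-ext (λ t → ≤⇒≤ᵇ (f (≤ᵇ⇒≤ _ _ t))) (λ t → ≤⇒≤ᵇ (g (≤ᵇ⇒≤ _ _ t)))

≤⇒≤ᵇ-true : ∀ {a b} → a ≤ b → (a ≤ᵇ b) ≡ true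
≤⇒≤ᵇ-true p = T-ext (λ _ → tt) (λ _ → ≤⇒≤ᵇ p)

<⇒<ᵇ-true : ∀ {a b} → a < b → (a <ᵇ b) ≡ true
<⇒<ᵇ-true p = T-ext (λ _ → tt) (λ _ → <⇒<ᵇ p)

>⇒≤ᵇ-false : ∀ {a b} → b < a → (a ≤ᵇ b) ≡ false
>⇒≤ᵇ-false p = T-ext (λ t → <⇒≱ p (≤ᵇ⇒≤ _ _ t)) ⊥-elim

≥⇒<ᵇ-false : ∀ {a b} → b ≤ a → (a <ᵇ b) ≡ false
≥⇒<ᵇ-false p = T-ext (λ t → ≤⇒≯ p (<ᵇ⇒< _ _ t)) ⊥-elim

ind : Bool → ℕ
ind b = if b then 1 else 0

ind-mono : ∀ {x y} → (T x → T y) → ind x ≤ ind y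
ind-mono {false}         _ = z≤n
ind-mono {true}  {true}  _ = ≤-refl
ind-mono {true}  {false} f = ⊥-elim (f tt)

allBelow⁻ : ∀ {k p} → T (allBelow k p) → ∀ {i} → i < k → T (p i)
allBelow⁻ {suc k} {p} t {i} i<1+k with m≤n⇒m<n∨m≡n (s≤s⁻¹ i<1+k)
... | inj₁ i<k  = allBelow⁻ {k} (proj₁ (T-∧⁻ t)) i<k
... | inj₂ refl = proj₂ (T-∧⁻ {allBelow k p} t)

allBelow⁺ : ∀ {k p} → (∀ {i} → i < k → T (p i)) → T (allBelow k p)
allBelow⁺ {zero}  h = tt
allBelow⁺ {suc k} h = T-∧⁺ (allBelow⁺ {k} (λ i<k → h (m<n⇒m<1+n i<k))) (h ≤-refl)

-- Reduces x ≤ y to p ≤ q and a semiring identity with slack s.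
linear : ∀ {p q x y} s → p ≤ q → x + q + s ≡ y + p → x ≤ y
linear {p} {q} {x} {y} s p≤q eq = +-cancelʳ-≤ p x y (begin
  x + p     ≤⟨ +-monoʳ-≤ x p≤q ⟩
  x + q     ≤⟨ m≤m+n (x + q) s ⟩
  x + q + s ≡⟨ eq ⟩
  y + p     ∎)
  where open ≤-Reasoning

-- Finite sums

sum-cong : ∀ k {f g} → (∀ {i} → i < k → f i ≡ g i) → sumBelow k f ≡ sumBelow k g
sum-cong zero    h = refl
sum-cong (suc k) h = cong₂ _+_ (sum-cong k (λ i<k → h (m<n⇒m<1+n i<k))) (h ≤-refl)

sum-mono : ∀ k {f g} → (∀ {i} → i < k → f i ≤ g i) → sumBelow k f ≤ sumBelow k g
sum-mono zero    h = z≤n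
sum-mono (suc k) h = +-mono-≤ (sum-mono k (λ i<k → h (m<n⇒m<1+n i<k))) (h ≤-refl)

sum-zero : ∀ k {f} → (∀ {i} → i < k → f i ≡ 0) → sumBelow k f ≡ 0
sum-zero zero    h = refl
sum-zero (suc k) h = cong₂ _+_ (sum-zero k (λ i<k → h (m<n⇒m<1+n i<k))) (h ≤-refl)

sum-distrib-+ : ∀ k f g → sumBelow k (λ i → f i + g i) ≡ sumBelow k f + sumBelow k g
sum-distrib-+ zero    f g = refl
sum-distrib-+ (suc k) f g rewrite sum-distrib-+ k f g =
  +-middle (sumBelow k f) (sumBelow k g) (f k) (g k)
  where
  +-middle : ∀ a b c d → a + b + (c + d) ≡ a + c + (b + d)
  +-middle = solve 4 (λ a b c d → a :+ b :+ (c :+ d) := a :+ c :+ (b :+ d)) refl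

sum-distribʳ-* : ∀ k f c → sumBelow k (λ i → f i * c) ≡ sumBelow k f * c
sum-distribʳ-* zero    f c = refl
sum-distribʳ-* (suc k) f c rewrite sum-distribʳ-* k f c = sym (*-distribʳ-+ c (sumBelow k f) (f k))

sum-const : ∀ k c → sumBelow k (λ _ → c) ≡ k * c
sum-const zero    c = refl
sum-const (suc k) c = trans (cong (_+ c) (sum-const k c)) (+-comm (k * c) c)

sum-swap : ∀ j k (f : ℕ → ℕ → ℕ) →
           sumBelow j (λ i → sumBelow k (f i)) ≡ sumBelow k (λ l → sumBelow j (λ i → f i l))
sum-swap zero    k f = sym (sum-zero k (λ _ → refl))
sum-swap (suc j) k f rewrite sum-swap j k f =
  sym (sum-distrib-+ k (λ l → sumBelow j (λ i → f i l)) (f j))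

sum-++ : ∀ j k f → sumBelow (j + k) f ≡ sumBelow j f + sumBelow k (λ i → f (j + i))
sum-++ j zero    f rewrite +-identityʳ j = sym (+-identityʳ _)
sum-++ j (suc k) f rewrite +-suc j k | sum-++ j k f =
  +-assoc (sumBelow j f) (sumBelow k (λ i → f (j + i))) (f (j + k))

sum-head : ∀ k f → sumBelow (suc k) f ≡ f 0 + sumBelow k (f ∘ suc)
sum-head k f = sum-++ 1 k f

sum-reverse : ∀ k f → sumBelow k f ≡ sumBelow k (λ i → f (k ∸ suc i))
sum-reverse zero    f = refl
sum-reverse (suc k) f =
  trans (cong (_+ f k) (sum-reverse k f))
        (trans (+-comm _ (f k)) (sym (sum-head k (λ i → f (k ∸ i)))))

count-sum : ∀ k p → count k p ≡ sumBelow k (ind ∘ p)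
count-sum zero    p = refl
count-sum (suc k) p = cong (_+ ind (p k)) (count-sum k p)

count-cong : ∀ k {p q} → (∀ {i} → i < k → p i ≡ q i) → count k p ≡ count k q
count-cong zero    h = refl
count-cong (suc k) h = cong₂ (λ c b → c + ind b) (count-cong k (λ i<k → h (m<n⇒m<1+n i<k))) (h ≤-refl)

count-zero : ∀ k {p} → (∀ {i} → i < k → p i ≡ false) → count k p ≡ 0
count-zero zero    h = refl
count-zero (suc k) h = cong₂ (λ c b → c + ind b) (count-zero k (λ i<k → h (m<n⇒m<1+n i<k))) (h ≤-refl)

count-++ : ∀ j k p → count (j + k) p ≡ count j p + count k (λ i → p (j + i))
count-++ j k p rewrite count-sum (j + k) p | count-sum j p | count-sum k (λ i → p (j + i)) =
  sum-++ j k (ind ∘ p)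

count-reverse : ∀ k p → count k p ≡ count k (λ i → p (k ∸ suc i))
count-reverse k p rewrite count-sum k p | count-sum k (λ i → p (k ∸ suc i)) = sum-reverse k (ind ∘ p)

-- The columns left of `A y` are cut at the values `A u`, one block for each horizontal run of the
-- path; a run of length 0 gives an empty block. Legs are constant on each block, so `pdinv` can be
-- evaluated block by block.
count-blocks : ∀ (A : ℕ → ℕ) p y → A 0 ≡ 0 → (∀ {u} → u < y → A u ≤ A (suc u)) →
               count (A y) p ≡ sumBelow y (λ u → count (A (suc u) ∸ A u) (λ t → p (A u + t)))
count-blocks A p zero    A0 mono rewrite A0 = refl
count-blocks A p (suc y) A0 mono = begin
  count (A (suc y)) p
    ≡⟨ cong (λ k → count k p) (m+[n∸m]≡n (mono ≤-refl)) ⟨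
  count (A y + (A (suc y) ∸ A y)) p
    ≡⟨ count-++ (A y) (A (suc y) ∸ A y) p ⟩
  count (A y) p + count (A (suc y) ∸ A y) (λ t → p (A y + t))
    ≡⟨ cong (_+ count (A (suc y) ∸ A y) (λ t → p (A y + t))) (count-blocks A p y A0 (λ u<y → mono (m<n⇒m<1+n u<y))) ⟩
  _ ∎
  where open ≡-Reasoning

triangle : ℕ → (ℕ → ℕ → ℕ) → ℕ
triangle n g = sumBelow n λ v → sumBelow v λ u → g u v

-- On the full square the two indices vary independently, so each can be permuted separately. Sums
-- over unordered pairs are brought to this form at the cost of a factor 2.
square-triangle : ∀ n g → (∀ u v → g u v ≡ g v u) → (∀ u → g u u ≡ 0) →
                  sumBelow n (λ v → sumBelow n (λ u → g u v)) ≡ triangle n g + triangle n g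
square-triangle zero    g s d = refl
square-triangle (suc n) g s d = begin
  sumBelow n (λ v → sumBelow n (λ u → g u v) + g n v) + (row + g n n)
    ≡⟨ cong₂ (λ x z → x + (row + z)) (sum-distrib-+ n _ (g n)) (d n) ⟩
  sumBelow n (λ v → sumBelow n (λ u → g u v)) + sumBelow n (g n) + (row + 0)
    ≡⟨ cong₂ (λ x z → x + z + (row + 0)) (square-triangle n g s d) (sum-cong n (λ {u} _ → s n u)) ⟩
  triangle n g + triangle n g + row + (row + 0)
    ≡⟨ double (triangle n g) row ⟩
  triangle n g + row + (triangle n g + row) ∎
  where
  open ≡-Reasoning
  row = sumBelow n (λ u → g u n)
  double : ∀ a b → a + a + b + (b + 0) ≡ a + b + (a + b)
  double = solve 2 (λ a b → a :+ a :+ b :+ (b :+ con 0) := a :+ b :+ (a :+ b)) refl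

-- Injections of {0, …, n-1} into itself

record Permutes (n : ℕ) (p : ℕ → ℕ) : Set where
  field
    bounded   : ∀ {i} → i < n → p i < n
    injective : ∀ {i j} → i < n → j < n → p i ≡ p j → i ≡ j

count-witness : ∀ k p → count k p ≢ 0 → ∃ λ i → i < k × T (p i)
count-witness zero    p h = contradiction refl h
count-witness (suc k) p h with p k in eq
... | true  = k , ≤-refl , subst T (sym eq) tt
... | false with count-witness k p (λ c≡0 → h (trans (+-identityʳ _) c≡0))
...   | i , i<k , t = i , m<n⇒m<1+n i<k , t

count-≤1 : ∀ k p → (∀ {i j} → i < k → j < k → T (p i) → T (p j) → i ≡ j) → count k p ≤ 1
count-≤1 zero    p u = z≤n
count-≤1 (suc k) p u with p k in eq
... | false rewrite +-identityʳ (count k p) = count-≤1 k p (λ i<k j<k → u (m<n⇒m<1+n i<k) (m<n⇒m<1+n j<k))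
... | true  = ≤-reflexive (cong (_+ 1) (count-zero k λ {i} i<k →
        T-ext (λ t → <-irrefl (u (m<n⇒m<1+n i<k) ≤-refl t (subst T (sym eq) tt)) i<k) ⊥-elim))

sum-≤ : ∀ k {f} → (∀ {i} → i < k → f i ≤ 1) → sumBelow k f ≤ k
sum-≤ k h = ≤-trans (sum-mono k h) (≤-reflexive (trans (sum-const k 1) (*-identityʳ k)))

-- The pigeonhole principle in additive form: terms bounded by 1 reach the total `k` only if none
-- falls short.
sum-full : ∀ k f → (∀ {i} → i < k → f i ≤ 1) → sumBelow k f ≡ k → ∀ {i} → i < k → f i ≡ 1
sum-full (suc k) f f≤1 eq {i} i<1+k with m≤n⇒m<n∨m≡n (s≤s⁻¹ i<1+k)
... | inj₂ refl = ≤-antisym (f≤1 ≤-refl) (+-cancelˡ-≤ k 1 (f k) (begin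
        k + 1            ≡⟨ +-comm k 1 ⟩
        suc k            ≡⟨ eq ⟨
        sumBelow k f + f k ≤⟨ +-monoˡ-≤ (f k) (sum-≤ k (λ i<k → f≤1 (m<n⇒m<1+n i<k))) ⟩
        k + f k          ∎))
  where
  open ≤-Reasoning
... | inj₁ i<k = sum-full k f (λ i<k → f≤1 (m<n⇒m<1+n i<k)) (≤-antisym (sum-≤ k (λ i<k → f≤1 (m<n⇒m<1+n i<k)))
        (+-cancelʳ-≤ 1 k _ (begin
        k + 1              ≡⟨ +-comm k 1 ⟩
        suc k              ≡⟨ eq ⟨
        sumBelow k f + f k ≤⟨ +-monoʳ-≤ (sumBelow k f) (f≤1 ≤-refl) ⟩
        sumBelow k f + 1   ∎))) i<k
  where
  open ≤-Reasoning

sum-≡ᵇ : ∀ k (f : ℕ → ℕ) {j} → j < k → sumBelow k (λ i → ind (j ≡ᵇ i) * f i) ≡ f j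
sum-≡ᵇ (suc k) f {j} j<1+k with m≤n⇒m<n∨m≡n (s≤s⁻¹ j<1+k)
... | inj₁ j<k rewrite sum-≡ᵇ k f j<k | T-ext {j ≡ᵇ k} {false} (λ t → <-irrefl (≡ᵇ⇒≡ j k t) j<k) ⊥-elim =
      +-identityʳ (f j)
... | inj₂ refl rewrite T-ext {j ≡ᵇ j} {true} (λ _ → tt) (λ _ → ≡⇒≡ᵇ j j refl)
      | sum-zero j {λ i → ind (j ≡ᵇ i) * f i} (λ {i} i<j →
          cong (λ b → ind b * f i) (T-ext {j ≡ᵇ i} {false} (λ t → <-irrefl (sym (≡ᵇ⇒≡ j i t)) i<j) ⊥-elim)) =
      *-identityˡ (f j)

module _ {n : ℕ} {p : ℕ → ℕ} (perm : Permutes n p) where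
  open Permutes perm
  private
    fibre : ℕ → ℕ
    fibre u = sumBelow n (λ i → ind (p i ≡ᵇ u))

    sum-fibres : ∀ f → sumBelow n (f ∘ p) ≡ sumBelow n (λ u → fibre u * f u)
    sum-fibres f = begin
      sumBelow n (f ∘ p)
        ≡⟨ sum-cong n (λ i<n → sum-≡ᵇ n f (bounded i<n)) ⟨
      sumBelow n (λ i → sumBelow n (λ u → ind (p i ≡ᵇ u) * f u))
        ≡⟨ sum-swap n n (λ i u → ind (p i ≡ᵇ u) * f u) ⟩
      sumBelow n (λ u → sumBelow n (λ i → ind (p i ≡ᵇ u) * f u))
        ≡⟨ sum-cong n (λ {u} _ → sum-distribʳ-* n (λ i → ind (p i ≡ᵇ u)) (f u)) ⟩
      sumBelow n (λ u → fibre u * f u) ∎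
      where open ≡-Reasoning

    -- Injectivity bounds each fibre by 1, while the `n` fibres together count all `n` arguments.
    fibre≡1 : ∀ {u} → u < n → fibre u ≡ 1
    fibre≡1 = sum-full n fibre
      (λ {u} _ → subst (_≤ 1) (count-sum n (λ i → p i ≡ᵇ u))
        (count-≤1 n (λ i → p i ≡ᵇ u) λ i<n j<n s t →
          injective i<n j<n (trans (≡ᵇ⇒≡ _ u s) (sym (≡ᵇ⇒≡ _ u t)))))
      (begin
        sumBelow n fibre                    ≡⟨ sum-cong n (λ {u} _ → *-identityʳ (fibre u)) ⟨
        sumBelow n (λ u → fibre u * 1)      ≡⟨ sum-fibres (λ _ → 1) ⟨
        sumBelow n (λ _ → 1)                ≡⟨ sum-const n 1 ⟩
        n * 1                               ≡⟨ *-identityʳ n ⟩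
        n                                   ∎)
      where open ≡-Reasoning

  sum-permute : ∀ f → sumBelow n (f ∘ p) ≡ sumBelow n f
  sum-permute f = trans (sum-fibres f) (sum-cong n λ {u} u<n →
    trans (cong (_* f u) (fibre≡1 u<n)) (*-identityˡ (f u)))

  surjective : ∀ {u} → u < n → ∃ λ i → i < n × p i ≡ u
  surjective {u} u<n with count-witness n (λ i → p i ≡ᵇ u)
    (λ c≡0 → 1+n≢0 (trans (sym (fibre≡1 u<n)) (trans (sym (count-sum n (λ i → p i ≡ᵇ u))) c≡0)))
  ... | i , i<n , t = i , i<n , ≡ᵇ⇒≡ (p i) u t

  -- Statistics of pairs of cars become statistics of pairs of rows in this way, whatever the
  -- labelling.
  triangle-permute : ∀ g → (∀ u v → g u v ≡ g v u) → (∀ u → g u u ≡ 0) →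
                     triangle n (λ i j → g (p i) (p j)) ≡ triangle n g
  triangle-permute g s d = *-cancelˡ-≡ _ _ 2 (begin
    2 * triangle n (λ i j → g (p i) (p j))
      ≡⟨ cong (triangle n (λ i j → g (p i) (p j)) +_) (+-identityʳ _) ⟩
    triangle n (λ i j → g (p i) (p j)) + triangle n (λ i j → g (p i) (p j))
      ≡⟨ square-triangle n (λ i j → g (p i) (p j)) (λ i j → s (p i) (p j)) (λ i → d (p i)) ⟨
    sumBelow n (λ j → sumBelow n (λ i → g (p i) (p j)))
      ≡⟨ sum-cong n (λ {j} _ → sum-permute (λ u → g u (p j))) ⟩
    sumBelow n (λ j → sumBelow n (λ u → g u (p j)))
      ≡⟨ sum-permute (λ v → sumBelow n (λ u → g u v)) ⟩
    sumBelow n (λ v → sumBelow n (λ u → g u v))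
      ≡⟨ square-triangle n g s d ⟩
    triangle n g + triangle n g
      ≡⟨ cong (triangle n g +_) (+-identityʳ _) ⟨
    2 * triangle n g ∎)
    where open ≡-Reasoning

-- Dyck paths, heights above the diagonal and ranks

record Dyck (m n : ℕ) (A : ℕ → ℕ) : Set where
  field
    mono  : ∀ {y} → suc y < n → A y ≤ A (suc y)
    above : ∀ {y} → y < n → n * A y ≤ m * y

-- On a Dyck path the truncated subtraction is exact by `above`, so heights and ranks can be treated
-- as natural numbers.
gap : (m n : ℕ) → (ℕ → ℕ) → ℕ → ℕ
gap m n A y = m * y ∸ n * A y

shift : (m n x : ℕ) → ℕ
shift m n x = fdiv (x * gcd m n) m

rank : (m n : ℕ) → (ℕ → ℕ) → ℕ → ℕ
rank m n A y = gap m n A y + shift m n (A y)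

<⇒∃ : ∀ {u v} → u < v → ∃ λ k → v ≡ suc (u + k)
<⇒∃ {u} {v} u<v = v ∸ suc u , sym (m+[n∸m]≡n u<v)

-- Cells on the same diagonal lie a multiple of m/d columns apart.
shift-jump : ∀ m n .{{_ : NonZero m}} {x x′ k} → n * x + m * suc k ≡ n * x′ → shift m n x < shift m n x′
shift-jump m@(suc _) n {x} {x′} {k} eq = begin
  suc (x * d / m)       ≡⟨ cong (_+ x * d / m) (n/n≡1 m) ⟨
  m / m + x * d / m     ≡⟨ +-distrib-/-∣ˡ (x * d) ∣-refl ⟨
  (m + x * d) / m       ≤⟨ /-monoˡ-≤ m (≤-trans (+-monoˡ-≤ (x * d) m≤δd) (≤-reflexive δd+xd)) ⟩
  x′ * d / m            ∎
  where
  open ≤-Reasoning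
  d = gcd m n
  x<x′ : x < x′
  x<x′ = *-cancelˡ-< n x x′ (subst (n * x <_) eq (m<m+n (n * x) z<s))
  δ = x′ ∸ x
  x+δ : x + δ ≡ x′
  x+δ = m+[n∸m]≡n (<⇒≤ x<x′)
  nδ : m * suc k ≡ n * δ
  nδ = +-cancelˡ-≡ (n * x) _ _ (trans eq (trans (cong (n *_) (sym x+δ)) (*-distribˡ-+ n x δ)))
  -- `m` divides both `δ * m` and `δ * n`, hence also their gcd `δ * d`. This multiple is positive,
  -- so the floor rises by at least 1.
  m∣δd : m ∣ δ * d
  m∣δd = subst (m ∣_) (sym (c*gcd[m,n]≡gcd[cm,cn] δ m n))
    (gcd-greatest (n∣m*n δ) (subst (m ∣_) (trans nδ (*-comm n δ)) (m∣m*n (suc k))))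
  m≤δd : m ≤ δ * d
  m≤δd = ∣⇒≤ {{m*n≢0 δ d {{>-nonZero (m<n⇒0<n∸m x<x′)}} {{≢-nonZero (gcd[m,n]≢0 m n (inj₁ 1+n≢0))}}}} m∣δd
  δd+xd : δ * d + x * d ≡ x′ * d
  δd+xd = trans (sym (*-distribʳ-+ d δ x)) (cong (_* d) (trans (+-comm δ x) x+δ))

shift-mono : ∀ m n {x x′} → x ≤ x′ → shift m n x ≤ shift m n x′
shift-mono zero      n x≤x′ = z≤n
shift-mono m@(suc _) n x≤x′ = /-monoˡ-≤ m (*-monoˡ-≤ (gcd m n) x≤x′)

shift-< : ∀ m n .{{_ : NonZero m}} {x} → x < m → shift m n x < gcd m n
shift-< m@(suc _) n {x} x<m = m<n*o⇒m/o<n (begin-strict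
  x * d <⟨ *-monoˡ-< d {{≢-nonZero (gcd[m,n]≢0 m n (inj₁ 1+n≢0))}} x<m ⟩
  m * d ≡⟨ *-comm m d ⟩
  d * m ∎)
  where
  open ≤-Reasoning
  d = gcd m n

∣-step : ∀ {d p q} → d ∣ p → d ∣ q → p < q → p + d ≤ q
∣-step {d} (divides-refl i) (divides-refl j) p<q = begin
  i * d + d ≡⟨ +-comm (i * d) d ⟩
  suc i * d ≤⟨ *-monoˡ-≤ d (*-cancelʳ-< d i j p<q) ⟩
  j * d     ∎
  where open ≤-Reasoning

-- Gaps are multiples of `gcd m n` and the floor term stays below it, so adding floor terms never
-- reverses a strict comparison of gaps.
∣-lift-< : ∀ {d p q s} t → d ∣ p → d ∣ q → p < q → s < d → p + s < q + t
∣-lift-< {d} {p} {q} {s} t d∣p d∣q p<q s<d = begin-strict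
  p + s <⟨ +-monoʳ-< p s<d ⟩
  p + d ≤⟨ ∣-step d∣p d∣q p<q ⟩
  q     ≤⟨ m≤m+n q t ⟩
  q + t ∎
  where open ≤-Reasoning

module _ {m n : ℕ} {A : ℕ → ℕ} .{{_ : NonZero m}} (path : Dyck m n A) where
  open Dyck path

  private
    D = gap m n A
    R = rank m n A
    f : ℕ → ℕ
    f y = shift m n (A y)
    d = gcd m n

  gap-≡ : ∀ {y} → y < n → n * A y + D y ≡ m * y
  gap-≡ y<n = m+[n∸m]≡n (above y<n)

  mono-≤ : ∀ {u v} → u ≤ v → v < n → A u ≤ A v
  mono-≤ {u} {zero}  z≤n v<n = ≤-refl
  mono-≤ {u} {suc v} u≤v v<n with m≤n⇒m<n∨m≡n u≤v
  ... | inj₂ refl = ≤-refl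
  ... | inj₁ u<v  = ≤-trans (mono-≤ (s≤s⁻¹ u<v) (<⇒≤ v<n)) (mono v<n)

  column<m : ∀ {y} → y < n → A y < m
  column<m {y} y<n = *-cancelˡ-< n (A y) m (begin-strict
    n * A y ≤⟨ above y<n ⟩
    m * y   <⟨ *-monoʳ-< m y<n ⟩
    m * n   ≡⟨ *-comm m n ⟩
    n * m   ∎)
    where open ≤-Reasoning

  first-column : 0 < n → A 0 ≡ 0
  first-column 0<n = n≤0⇒n≡0 (*-cancelˡ-≤ n {{>-nonZero 0<n}} (begin
    n * A 0 ≤⟨ above 0<n ⟩
    m * 0   ≡⟨ *-zeroʳ m ⟩
    0       ≡⟨ *-zeroʳ n ⟨
    n * 0   ∎))
    where open ≤-Reasoning

  gcd∣gap : ∀ {y} → y < n → d ∣ D y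
  gcd∣gap {y} y<n = ∣m+n∣m⇒∣n
    (subst (d ∣_) (sym (gap-≡ y<n)) (∣m⇒∣m*n y (gcd[m,n]∣m m n)))
    (∣m⇒∣m*n (A y) (gcd[m,n]∣n m n))

  private
    f< : ∀ {y} → y < n → f y < d
    f< y<n = shift-< m n (column<m y<n)

    gcd∣gap+m : ∀ {y} → y < n → d ∣ D y + m
    gcd∣gap+m y<n = ∣m∣n⇒∣m+n (gcd∣gap y<n) (gcd[m,n]∣m m n)

    swapʳ : ∀ a b c → a + b + c ≡ a + c + b
    swapʳ = solve 3 (λ a b c → a :+ b :+ c := a :+ c :+ b) refl

    -- Used with `s = 0` for two rows of equal gap and with `s = 1` when the lower row has a gap
    -- larger by exactly `m`, the edge of the window in `tdinv`. Either way `n` times the column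
    -- difference is a positive multiple of `m`, and `shift-jump` applies.
    jump : ∀ {u k} s → suc (u + k) < n → D u ≡ D (suc (u + k)) + m * s → f u < f (suc (u + k))
    jump {u} {k} s v<n eq = shift-jump m n {k = k + s} (+-cancelʳ-≡ δ _ _ (begin
      n * A u + m * suc (k + s) + δ       ≡⟨ split (n * A u) m k s δ ⟩
      n * A u + (δ + m * s) + m * suc k   ≡⟨ cong (λ z → n * A u + z + m * suc k) eq ⟨
      n * A u + D u + m * suc k           ≡⟨ cong (_+ m * suc k) (gap-≡ (<-trans (s≤s (m≤m+n u k)) v<n)) ⟩
      m * u + m * suc k                   ≡⟨ join m u k ⟩
      m * suc (u + k)                     ≡⟨ gap-≡ v<n ⟨
      n * A (suc (u + k)) + δ             ∎))
      where
      open ≡-Reasoning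
      δ = D (suc (u + k))
      split : ∀ a m k s δ → a + m * suc (k + s) + δ ≡ a + (δ + m * s) + m * suc k
      split = solve 5 (λ a m k s δ → a :+ m :* (one :+ (k :+ s)) :+ δ := a :+ (δ :+ m :* s) :+ m :* (one :+ k)) refl
      join : ∀ m u k → m * u + m * suc k ≡ m * suc (u + k)
      join = solve 3 (λ m u k → m :* u :+ m :* (one :+ k) := m :* (one :+ (u :+ k))) refl

  rank-up : ∀ {u v} → u < v → v < n → D u ≤ D v → R u < R v
  rank-up {u} {v} u<v v<n Du≤Dv with m≤n⇒m<n∨m≡n Du≤Dv
  ... | inj₁ Du<Dv = ∣-lift-< (f v) (gcd∣gap (<-trans u<v v<n)) (gcd∣gap v<n) Du<Dv (f< (<-trans u<v v<n))
  ... | inj₂ Du≡Dv with <⇒∃ u<v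
  ...   | k , refl = +-mono-≤-< Du≤Dv (jump 0 v<n (trans Du≡Dv (sym (trans (cong (D v +_) (*-zeroʳ m)) (+-identityʳ _)))))

  rank-down : ∀ {u v} → u < v → v < n → D v < D u → R v < R u
  rank-down {u} u<v v<n Dv<Du = ∣-lift-< (f u) (gcd∣gap v<n) (gcd∣gap (<-trans u<v v<n)) Dv<Du (f< v<n)

  -- This and the next three bounds compare gaps at distance `m`. Since `gcd m n` divides `m`, the
  -- tie-breaking argument carries over, and on the boundary the floor terms again favour the upper
  -- row `v`.
  rank-up-within : ∀ {u v} → u < v → v < n → D v < D u + m → R v < R u + m
  rank-up-within {u} {v} u<v v<n p = subst (R v <_) (swapʳ (D u) m (f u))
    (∣-lift-< (f u) (gcd∣gap v<n) (gcd∣gap+m (<-trans u<v v<n)) p (f< v<n))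

  rank-up-beyond : ∀ {u v} → u < v → v < n → D u + m ≤ D v → R u + m ≤ R v
  rank-up-beyond {u} {v} u<v v<n p = subst (_≤ R v) (swapʳ (D u) m (f u))
    (+-mono-≤ p (shift-mono m n (mono-≤ (<⇒≤ u<v) v<n)))

  rank-down-within : ∀ {u v} → u < v → v < n → D u ≤ D v + m → R u < R v + m
  rank-down-within {u} {v} u<v v<n p with m≤n⇒m<n∨m≡n p
  ... | inj₁ q = subst (R u <_) (swapʳ (D v) m (f v))
                   (∣-lift-< (f v) (gcd∣gap (<-trans u<v v<n)) (gcd∣gap+m v<n) q (f< (<-trans u<v v<n)))
  ... | inj₂ q with <⇒∃ u<v
  ...   | k , refl = subst (R u <_) (swapʳ (D v) m (f v))
                       (+-mono-≤-< p (jump 1 v<n (trans q (cong (D v +_) (sym (*-identityʳ m))))))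

  rank-down-beyond : ∀ {u v} → u < v → v < n → D v + m < D u → R v + m ≤ R u
  rank-down-beyond {u} {v} u<v v<n p = subst (_≤ R u) (swapʳ (D v) m (f v))
    (<⇒≤ (∣-lift-< (f u) (gcd∣gap+m v<n) (gcd∣gap (<-trans u<v v<n)) p (f< v<n)))

  rank-<⇔ : ∀ {u v} → u < v → v < n → (R u <ᵇ R v) ≡ (D u ≤ᵇ D v)
  rank-<⇔ u<v v<n = T-ext
    (λ t → ≤⇒≤ᵇ (≮⇒≥ λ q → <-asym (<ᵇ⇒< _ _ t) (rank-down u<v v<n q)))
    (λ t → <⇒<ᵇ (rank-up u<v v<n (≤ᵇ⇒≤ _ _ t)))

  rank->⇔ : ∀ {u v} → u < v → v < n → (R v <ᵇ R u) ≡ (D v <ᵇ D u)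
  rank->⇔ u<v v<n = <ᵇ-cong
    (λ t → ≰⇒> λ q → <-asym t (rank-up u<v v<n q))
    (rank-down u<v v<n)

-- Pairs of rows of nearby rank

window : (m n : ℕ) → (ℕ → ℕ) → ℕ → ℕ → Bool
window m n A u v = (rank m n A u <ᵇ rank m n A v) ∧ (rank m n A v <ᵇ rank m n A u + m)

-- At most one of the two windows holds, so this is the indicator that two distinct ranks differ by
-- less than `m`. It is symmetric and zero on the diagonal, as `triangle-permute` requires.
attack : (m n : ℕ) → (ℕ → ℕ) → ℕ → ℕ → ℕ
attack m n A u v = ind (window m n A u v) + ind (window m n A v u)

attack-sym : ∀ m n A u v → attack m n A u v ≡ attack m n A v u
attack-sym m n A u v = +-comm (ind (window m n A u v)) _

attack-diag : ∀ m n A u → attack m n A u u ≡ 0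
attack-diag m n A u rewrite ≥⇒<ᵇ-false (≤-refl {rank m n A u}) = refl

-- Together the two terms say `-m ≤ D v - D u < m`; the half-open form records that ties go to the
-- upper row `v`.
attack-gaps : ∀ {m n A} .{{_ : NonZero m}} → Dyck m n A → ∀ {u v} → u < v → v < n →
  let D = gap m n A in
  attack m n A u v ≡ ind ((D u ≤ᵇ D v) ∧ (D v <ᵇ D u + m)) + ind ((D v <ᵇ D u) ∧ (D u ≤ᵇ D v + m))
attack-gaps {m} {n} {A} path {u} {v} u<v v<n = cong₂ (λ b c → ind b + ind c)
  (cong₂ _∧_ (rank-<⇔ path u<v v<n) (<ᵇ-cong
    (λ t → ≰⇒> λ q → ≤⇒≯ (rank-up-beyond path u<v v<n q) t)
    (rank-up-within path u<v v<n)))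
  (cong₂ _∧_ (rank->⇔ path u<v v<n) (T-ext
    (λ t → ≤⇒≤ᵇ (≮⇒≥ λ q → ≤⇒≯ (rank-down-beyond path u<v v<n q) (<ᵇ⇒< _ _ t)))
    (λ t → <⇒<ᵇ (rank-down-within path u<v v<n (≤ᵇ⇒≤ _ _ t)))))

-- Arms, legs and `pdinv` along horizontal runs

∸-flip : ∀ {i n} → i < n → n ∸ suc (n ∸ suc i) ≡ i
∸-flip {i} {suc n} (s≤s i≤n) = m∸[m∸n]≡n i≤n

∸-flip-< : ∀ {i n} → i < n → n ∸ suc i < n
∸-flip-< {i} {suc n} _ = s≤s (m∸n≤m n i)

at-∷ʳ-last : ∀ {n} (v : Vec ℕ n) x → at (v ∷ʳ x) n 0 ≡ x
at-∷ʳ-last []      x = refl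
at-∷ʳ-last (y ∷ v) x = at-∷ʳ-last v x

at-∷ʳ-init : ∀ {n} (v : Vec ℕ n) x {i} → i < n → at (v ∷ʳ x) i 0 ≡ at v i 0
at-∷ʳ-init (y ∷ v) x {zero}  _   = refl
at-∷ʳ-init (y ∷ v) x {suc i} i<n = at-∷ʳ-init v x (s≤s⁻¹ i<n)

at-reverse : ∀ {n} (v : Vec ℕ n) {i} → i < n → at (reverse v) i 0 ≡ at v (n ∸ suc i) 0
at-reverse {suc n} (x ∷ v) {i} i<1+n rewrite reverse-∷ x v with m≤n⇒m<n∨m≡n (s≤s⁻¹ i<1+n)
... | inj₂ refl rewrite n∸n≡0 n = at-∷ʳ-last (reverse v) x
... | inj₁ i<n rewrite at-∷ʳ-init (reverse v) x i<n | at-reverse v i<n | +-∸-assoc 1 i<n = refl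

count-all : ∀ k {p} → (∀ {i} → i < k → p i ≡ true) → count k p ≡ k
count-all k {p} h rewrite count-cong k h | count-sum k (λ _ → true) = trans (sum-const k 1) (*-identityʳ k)

legOf : (ℕ → ℕ) → ℕ → ℕ → ℕ
legOf A y j = count y (λ v → j <ᵇ A v)

goodCell : (m n arm leg : ℕ) → Bool
goodCell m n arm leg = (arm * n ≤ᵇ m * suc leg) ∧ ((leg ≡ᵇ 0) ∨ (m * leg <ᵇ n * suc arm))

leg-reverse : ∀ {n} (a : Vec ℕ n) {y} j → y < n →
  count n (λ i′ → ((n ∸ suc y) <ᵇ i′) ∧ (j <ᵇ at (reverse a) i′ 0)) ≡ legOf (λ v → at a v 0) y j
leg-reverse {n} a {y} j y<n = begin
  count n (λ i′ → ((n ∸ suc y) <ᵇ i′) ∧ (j <ᵇ at (reverse a) i′ 0))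
    ≡⟨ count-reverse n _ ⟩
  count n (λ v → ((n ∸ suc y) <ᵇ (n ∸ suc v)) ∧ (j <ᵇ at (reverse a) (n ∸ suc v) 0))
    ≡⟨ count-cong n (λ {v} v<n → cong₂ _∧_
         (<ᵇ-cong (λ p → s≤s⁻¹ (∸-reflectsʳ-< {n} p)) (λ v<y → ∸-monoʳ-< (s≤s v<y) y<n))
         (cong (j <ᵇ_) (trans (at-reverse a (∸-flip-< v<n)) (cong (λ z → at a z 0) (∸-flip v<n))))) ⟩
  count n (λ v → (v <ᵇ y) ∧ (j <ᵇ at a v 0))
    ≡⟨ cong (λ k → count k (λ v → (v <ᵇ y) ∧ (j <ᵇ at a v 0))) (m+[n∸m]≡n (<⇒≤ y<n)) ⟨
  count (y + (n ∸ y)) (λ v → (v <ᵇ y) ∧ (j <ᵇ at a v 0))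
    ≡⟨ count-++ y (n ∸ y) _ ⟩
  count y (λ v → (v <ᵇ y) ∧ (j <ᵇ at a v 0)) + count (n ∸ y) (λ v → (y + v <ᵇ y) ∧ (j <ᵇ at a (y + v) 0))
    ≡⟨ cong₂ _+_ (count-cong y (λ {v} v<y → cong (_∧ (j <ᵇ at a v 0)) (<⇒<ᵇ-true v<y)))
                 (count-zero (n ∸ y) (λ {v} _ → cong (_∧ (j <ᵇ at a (y + v) 0)) (≥⇒<ᵇ-false (m≤m+n y v)))) ⟩
  count y (λ v → j <ᵇ at a v 0) + 0
    ≡⟨ +-identityʳ _ ⟩
  count y (λ v → j <ᵇ at a v 0) ∎
  where
  open ≡-Reasoning
  ∸-reflectsʳ-< : ∀ {n a b} → n ∸ a < n ∸ b → b < a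
  ∸-reflectsʳ-< {n} p = ≰⇒> λ q → <⇒≱ p (∸-monoʳ-≤ n q)

-- The partition numbers its rows from the top and the path from the bottom. After reversal the
-- cells below a cell of row `y` lie in rows `v < y`.
pdinv-rows : ∀ m {n} (a : Vec ℕ n) → let A = λ y → at a y 0 in
  pdinv m n a ≡ sumBelow n (λ y → count (A y) (λ j → goodCell m n (A y ∸ suc j) (legOf A y j)))
pdinv-rows m {n} a = trans (sum-reverse n _) (sum-cong n λ {y} y<n →
  trans (cong (λ l → count l (λ j → goodCell m n (l ∸ suc j) (leg y j))) (row y<n))
        (count-cong (at a y 0) λ {j} _ → cong (goodCell m n (at a y 0 ∸ suc j)) (leg-reverse a j y<n)))
  where
  leg : ℕ → ℕ → ℕ
  leg y j = count n (λ i′ → ((n ∸ suc y) <ᵇ i′) ∧ (j <ᵇ at (reverse a) i′ 0))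
  row : ∀ {y} → y < n → at (reverse a) (n ∸ suc y) 0 ≡ at a y 0
  row y<n = trans (at-reverse a (∸-flip-< y<n)) (cong (λ z → at a z 0) (∸-flip y<n))

-- goodCell for row y and a column a_u ≤ j < a_{u+1}, in terms of the gap δ of row y.
hit : (m n δ u j : ℕ) → Bool
hit m n δ u j = (δ + n * j <ᵇ m * suc u) ∧ (m * suc u ≤ᵇ δ + n + m + n * j)

-- The hypothesis is the gap equation of row `suc (u + l)` with column `suc (j + k)`, where `k` is
-- the arm and `l` the leg. Adding it turns the first inequality of `goodCell` into the upper end,
-- and the second into the lower end, of a window for the height `m * suc u - n * j`.
goodCell-hit : ∀ m n δ u l j k → 0 < n → n * suc (j + k) + δ ≡ m * suc (u + l) →
               goodCell m n k l ≡ hit m n δ u j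
goodCell-hit m n δ u l j k 0<n eq = begin
  (k * n ≤ᵇ m * suc l) ∧ ((l ≡ᵇ 0) ∨ (m * l <ᵇ n * suc k))
    ≡⟨ cong ((k * n ≤ᵇ m * suc l) ∧_) (absorb l) ⟩
  (k * n ≤ᵇ m * suc l) ∧ (m * l <ᵇ n * suc k)
    ≡⟨ cong₂ _∧_
         (≤ᵇ-cong {k * n} {m * suc l} {m * suc u} {δ + n + m + n * j}
                  (λ p → linear 0 (+-mono-≤ p (≤-reflexive (sym eq))) (up m n δ u l j k))
                  (λ p → linear 0 (+-mono-≤ p (≤-reflexive eq)) (up′ m n δ u l j k)))
         (<ᵇ-cong {m * l} {n * suc k} {δ + n * j} {m * suc u}
                  (λ p → linear 0 (+-mono-≤ p (≤-reflexive eq)) (lo m n δ u l j k))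
                  (λ p → linear 0 (+-mono-≤ p (≤-reflexive (sym eq))) (lo′ m n δ u l j k))) ⟩
  (m * suc u ≤ᵇ δ + n + m + n * j) ∧ (δ + n * j <ᵇ m * suc u)
    ≡⟨ ∧-comm _ (δ + n * j <ᵇ m * suc u) ⟩
  hit m n δ u j ∎
  where
  open ≡-Reasoning
  -- For leg 0 the strict inequality holds by itself because `0 < n`, which accounts for the
  -- convention that division by 0 gives infinity.
  absorb : ∀ l → (l ≡ᵇ 0) ∨ (m * l <ᵇ n * suc k) ≡ (m * l <ᵇ n * suc k)
  absorb (suc l) = refl
  absorb zero    = sym (<⇒<ᵇ-true (subst (_< n * suc k) (sym (*-zeroʳ m)) (*-mono-≤ 0<n (s≤s (z≤n {k})))))
  up : ∀ m n δ u l j k → m * suc u + (m * suc l + (n * suc (j + k) + δ)) + 0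
                       ≡ δ + n + m + n * j + (k * n + m * suc (u + l))
  up = solve 7 (λ m n δ u l j k →
       m :* (one :+ u) :+ (m :* (one :+ l) :+ (n :* (one :+ (j :+ k)) :+ δ)) :+ con 0
    := δ :+ n :+ m :+ n :* j :+ (k :* n :+ m :* (one :+ (u :+ l)))) refl
  up′ : ∀ m n δ u l j k → k * n + (δ + n + m + n * j + m * suc (u + l)) + 0
                        ≡ m * suc l + (m * suc u + (n * suc (j + k) + δ))
  up′ = solve 7 (λ m n δ u l j k →
       k :* n :+ (δ :+ n :+ m :+ n :* j :+ m :* (one :+ (u :+ l))) :+ con 0
    := m :* (one :+ l) :+ (m :* (one :+ u) :+ (n :* (one :+ (j :+ k)) :+ δ))) refl
  lo : ∀ m n δ u l j k → suc (δ + n * j) + (n * suc k + m * suc (u + l)) + 0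
                       ≡ m * suc u + (suc (m * l) + (n * suc (j + k) + δ))
  lo = solve 7 (λ m n δ u l j k →
       one :+ (δ :+ n :* j) :+ (n :* (one :+ k) :+ m :* (one :+ (u :+ l))) :+ con 0
    := m :* (one :+ u) :+ (one :+ m :* l :+ (n :* (one :+ (j :+ k)) :+ δ))) refl
  lo′ : ∀ m n δ u l j k → suc (m * l) + (m * suc u + (n * suc (j + k) + δ)) + 0
                        ≡ n * suc k + (suc (δ + n * j) + m * suc (u + l))
  lo′ = solve 7 (λ m n δ u l j k →
       one :+ m :* l :+ (m :* (one :+ u) :+ (n :* (one :+ (j :+ k)) :+ δ)) :+ con 0
    := n :* (one :+ k) :+ (one :+ (δ :+ n :* j) :+ m :* (one :+ (u :+ l)))) refl

-- The contribution to `pdinv` of the cells of row `y` over the run between rows `u` and `suc u`.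
hits : (m n : ℕ) → (ℕ → ℕ) → ℕ → ℕ → ℕ
hits m n A u y = count (A (suc u) ∸ A u) λ t → hit m n (gap m n A y) u (A u + t)

module _ {m n : ℕ} {A : ℕ → ℕ} .{{_ : NonZero m}} (path : Dyck m n A) where

  -- Rows up to `u` end at or before the column `A u + t`, and rows from `suc u` on reach past it,
  -- so the leg counts exactly the rows strictly between `u` and `y`.
  leg-block : ∀ {u y t} → u < y → y < n → t < A (suc u) ∸ A u → suc (u + legOf A y (A u + t)) ≡ y
  leg-block {u} {y} {t} u<y y<n t< with <⇒∃ u<y
  ... | l , refl = cong (λ z → suc (u + z)) (begin
    count (suc u + l) (λ v → A u + t <ᵇ A v)
      ≡⟨ count-++ (suc u) l _ ⟩
    count (suc u) (λ v → A u + t <ᵇ A v) + count l (λ v → A u + t <ᵇ A (suc u + v))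
      ≡⟨ cong₂ _+_
           (count-zero (suc u) (λ v≤u → ≥⇒<ᵇ-false
             (≤-trans (mono-≤ path (s≤s⁻¹ v≤u) (<-trans u<y y<n)) (m≤m+n (A u) t))))
           (count-all l (λ {v} v<l → <⇒<ᵇ-true (<-≤-trans below
             (mono-≤ path (m≤m+n (suc u) v) (<-trans (+-monoʳ-< (suc u) v<l) y<n))))) ⟩
    l ∎)
    where
    open ≡-Reasoning
    below : A u + t < A (suc u)
    below = subst (A u + t <_) (m+[n∸m]≡n (mono-≤ path (n≤1+n u) (≤-<-trans u<y y<n))) (+-monoʳ-< (A u) t<)

  row-hits : ∀ {y} → y < n →
    count (A y) (λ j → goodCell m n (A y ∸ suc j) (legOf A y j)) ≡ sumBelow y (λ u → hits m n A u y)
  row-hits {y} y<n = trans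
    (count-blocks A _ y (first-column path (≤-<-trans z≤n y<n)) (λ u<y → Dyck.mono path (≤-<-trans u<y y<n)))
    (sum-cong y λ {u} u<y → count-cong (A (suc u) ∸ A u) λ {t} t< →
      goodCell-hit m n (gap m n A y) u (legOf A y (A u + t)) (A u + t) (A y ∸ suc (A u + t)) (≤-<-trans z≤n y<n)
        (trans (cong (λ z → n * z + gap m n A y) (m+[n∸m]≡n (below u<y t<)))
               (trans (gap-≡ path y<n) (cong (m *_) (sym (leg-block u<y y<n t<))))))
    where
    below : ∀ {u t} → u < y → t < A (suc u) ∸ A u → A u + t < A y
    below {u} {t} u<y t< = <-≤-trans
      (subst (A u + t <_) (m+[n∸m]≡n (mono-≤ path (n≤1+n u) (≤-<-trans u<y y<n))) (+-monoʳ-< (A u) t<))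
      (mono-≤ path u<y y<n)

pdinv-hits : ∀ {m n} .{{_ : NonZero m}} (a : Vec ℕ n) → Dyck m n (λ y → at a y 0) →
             pdinv m n a ≡ triangle n (hits m n (λ y → at a y 0))
pdinv-hits {m} {n} a path = trans (pdinv-rows m a) (sum-cong n (row-hits path))

-- Half-open windows and telescoping sums

within : (a b w : ℕ) → Bool
within a b w = (a <ᵇ w) ∧ (w ≤ᵇ b)

within-split : ∀ {a b c} w → a ≤ b → b ≤ c →
               ind (within a c w) ≡ ind (within a b w) + ind (within b c w)
within-split {a} {b} {c} w a≤b b≤c with ≤-<-connex w b
... | inj₁ w≤b rewrite ≥⇒<ᵇ-false w≤b | ≤⇒≤ᵇ-true w≤b | ≤⇒≤ᵇ-true (≤-trans w≤b b≤c) = sym (+-identityʳ _)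
... | inj₂ b<w rewrite <⇒<ᵇ-true b<w | <⇒<ᵇ-true (≤-<-trans a≤b b<w) | >⇒≤ᵇ-false b<w = refl

within-<ᵇ : ∀ {a b} w → a ≤ b → ind (within a b w) + ind (b <ᵇ w) ≡ ind (a <ᵇ w)
within-<ᵇ {a} {b} w a≤b with ≤-<-connex w b
... | inj₁ w≤b rewrite ≥⇒<ᵇ-false w≤b | ≤⇒≤ᵇ-true w≤b | ∧-identityʳ (a <ᵇ w) = +-identityʳ _
... | inj₂ b<w rewrite <⇒<ᵇ-true b<w | >⇒≤ᵇ-false b<w | <⇒<ᵇ-true (≤-<-trans a≤b b<w) = refl

ind-≤ᵇ+<ᵇ : ∀ a b → ind (a ≤ᵇ b) + ind (b <ᵇ a) ≡ 1
ind-≤ᵇ+<ᵇ a b with ≤-<-connex a b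
... | inj₁ a≤b rewrite ≤⇒≤ᵇ-true a≤b | ≥⇒<ᵇ-false a≤b = refl
... | inj₂ b<a rewrite >⇒≤ᵇ-false b<a | <⇒<ᵇ-true b<a = refl

-- The upper end of each interval is the lower end of the next, so the `g` intervals tile one long
-- half-open interval.
count-telescope : ∀ L n w j g →
  count g (λ t → within (L + n * (j + t)) (n + L + n * (j + t)) w) + ind (L + n * (j + g) <ᵇ w)
    ≡ ind (L + n * j <ᵇ w)
count-telescope L n w j zero rewrite +-identityʳ j = refl
count-telescope L n w j (suc g) = begin
  count g p + ind (p g) + ind (L + n * (j + suc g) <ᵇ w)
    ≡⟨ cong (λ z → count g p + ind (p g) + ind (z <ᵇ w)) (step L n j g) ⟩
  count g p + ind (p g) + ind (n + L + n * (j + g) <ᵇ w)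
    ≡⟨ +-assoc (count g p) _ _ ⟩
  count g p + (ind (p g) + ind (n + L + n * (j + g) <ᵇ w))
    ≡⟨ cong (count g p +_) (within-<ᵇ w (+-monoˡ-≤ (n * (j + g)) (m≤n+m L n))) ⟩
  count g p + ind (L + n * (j + g) <ᵇ w)
    ≡⟨ count-telescope L n w j g ⟩
  ind (L + n * j <ᵇ w) ∎
  where
  open ≡-Reasoning
  p = λ t → within (L + n * (j + t)) (n + L + n * (j + t)) w
  step : ∀ L n j g → L + n * (j + suc g) ≡ n + L + n * (j + g)
  step = solve 4 (λ L n j g → L :+ n :* (j :+ (one :+ g)) := n :+ L :+ n :* (j :+ g)) refl

<ᵇ-shift : ∀ {a b} c d k l → a + k ≡ c + l → b + k ≡ d + l → (a <ᵇ b) ≡ (c <ᵇ d)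
<ᵇ-shift {a} {b} c d k l p q = <ᵇ-cong
  (λ a<b → +-cancelʳ-< l c d (subst₂ _<_ p q (+-monoˡ-< k a<b)))
  (λ c<d → +-cancelʳ-< k a b (subst₂ _<_ (sym p) (sym q) (+-monoˡ-< l c<d)))

≤ᵇ-shift : ∀ {a b} c d k l → a + k ≡ c + l → b + k ≡ d + l → (a ≤ᵇ b) ≡ (c ≤ᵇ d)
≤ᵇ-shift {a} {b} c d k l p q = ≤ᵇ-cong
  (λ a≤b → +-cancelʳ-≤ l c d (subst₂ _≤_ p q (+-monoˡ-≤ k a≤b)))
  (λ c≤d → +-cancelʳ-≤ k a b (subst₂ _≤_ (sym p) (sym q) (+-monoˡ-≤ l c≤d)))

-- If `e ≤ δ`, both sides reduce to the indicator of `δ < e + (m + n)`; if `δ < e`, both equal 1.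
-- With `e = D u` and `δ = D y` this merges the new cell of a run and the remainder of the
-- telescoping sum into `attack`.
boundary : ∀ m n e δ →
  ind ((δ <ᵇ e + (m + n)) ∧ (e ≤ᵇ δ + n)) + ind (δ + n <ᵇ e)
    ≡ ind ((e ≤ᵇ δ) ∧ (δ <ᵇ e + (m + n))) + ind ((δ <ᵇ e) ∧ (e ≤ᵇ δ + (m + n))) + ind (δ + (m + n) <ᵇ e)
boundary m n e δ with ≤-<-connex e δ
... | inj₁ e≤δ rewrite ≤⇒≤ᵇ-true e≤δ | ≥⇒<ᵇ-false e≤δ
      | ≤⇒≤ᵇ-true (≤-trans e≤δ (m≤m+n δ n)) | ≥⇒<ᵇ-false (≤-trans e≤δ (m≤m+n δ n))
      | ≥⇒<ᵇ-false (≤-trans e≤δ (m≤m+n δ (m + n))) | ∧-identityʳ (δ <ᵇ e + (m + n)) = sym (+-identityʳ _)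
... | inj₂ δ<e rewrite >⇒≤ᵇ-false δ<e | <⇒<ᵇ-true δ<e | <⇒<ᵇ-true (≤-trans δ<e (m≤m+n e (m + n))) =
      trans (ind-≤ᵇ+<ᵇ e (δ + n)) (sym (ind-≤ᵇ+<ᵇ e (δ + (m + n))))

-- The shear and the growth of `pdinv`

module _ {m n : ℕ} {A B : ℕ → ℕ} .{{_ : NonZero m}} (path : Dyck m n A) (shear : ∀ {y} → y < n → B y ≡ A y + y) where

  gap-shear : ∀ {y} → y < n → gap (m + n) n B y ≡ gap m n A y
  gap-shear {y} y<n rewrite shear y<n | *-distribʳ-+ y m n | *-distribˡ-+ n (A y) y =
    [m+o]∸[n+o]≡m∸n (m * y) (n * A y) (n * y)
    where
    [m+o]∸[n+o]≡m∸n : ∀ a b c → (a + c) ∸ (b + c) ≡ a ∸ b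
    [m+o]∸[n+o]≡m∸n a b c rewrite +-comm a c | +-comm b c = [m+n]∸[m+o]≡n∸o c a b

  dyck-shear : Dyck (m + n) n B
  dyck-shear = record
    { mono  = λ {y} y< → subst₂ _≤_ (sym (shear (<⇒≤ y<))) (sym (shear y<)) (+-mono-≤ (Dyck.mono path y<) (n≤1+n y))
    ; above = λ {y} y< → subst₂ _≤_
        (trans (sym (*-distribˡ-+ n (A y) y)) (cong (n *_) (sym (shear y<))))
        (sym (*-distribʳ-+ y m n)) (+-monoˡ-≤ (n * y) (Dyck.above path y<))
    }

  private
    D = gap m n A
    instance
      m+n≢0 : NonZero (m + n)
      m+n≢0 = >-nonZero (≤-trans (>-nonZero⁻¹ m) (m≤m+n m n))

  -- The final indicators on the two sides are one function of the row, taken at `suc u` and at `u`,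
  -- so they cancel in the sum over `u`. What remains of the growth is the `attack` of the pair.
  hits-shear : ∀ {u y} → u < y → y < n →
    hits (m + n) n B u y + ind (D y + (m + n) <ᵇ D (suc u))
      ≡ hits m n A u y + attack (m + n) n B u y + ind (D y + (m + n) <ᵇ D u)
  hits-shear {u} {y} u<y y<n = begin
    hits (m + n) n B u y + ind (L <ᵇ D (suc u))
      ≡⟨ cong (_+ ind (L <ᵇ D (suc u))) (cong₂ (λ k p → count k p) width refl) ⟩
    count (1 + g) (λ t → hit (m + n) n (gap (m + n) n B y) u (B u + t)) + ind (L <ᵇ D (suc u))
      ≡⟨ cong (_+ ind (L <ᵇ D (suc u))) (count-cong (1 + g) λ {t} _ →
           cong₂ (λ δ b → hit (m + n) n δ u (b + t)) (gap-shear y<n) (shear u<n)) ⟩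
    count (1 + g) (λ t → hit (m + n) n δ u (A u + u + t)) + ind (L <ᵇ D (suc u))
      ≡⟨ cong (_+ ind (L <ᵇ D (suc u))) (count-++ 1 g _) ⟩
    ind (hit (m + n) n δ u (A u + u + 0)) + count g (λ t → hit (m + n) n δ u (A u + u + suc t)) + ind (L <ᵇ D (suc u))
      ≡⟨ cong₂ (λ x z → x + z + ind (L <ᵇ D (suc u))) (cong ind first) rest ⟩
    ind ((δ <ᵇ D u + (m + n)) ∧ (D u ≤ᵇ δ + n)) + (hits m n A u y + extra) + ind (L <ᵇ D (suc u))
      ≡⟨ arrange (ind ((δ <ᵇ D u + (m + n)) ∧ (D u ≤ᵇ δ + n))) (hits m n A u y) extra _ ⟩
    hits m n A u y + (ind ((δ <ᵇ D u + (m + n)) ∧ (D u ≤ᵇ δ + n)) + (extra + ind (L <ᵇ D (suc u))))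
      ≡⟨ cong (λ z → hits m n A u y + (ind ((δ <ᵇ D u + (m + n)) ∧ (D u ≤ᵇ δ + n)) + z)) extra-≡ ⟩
    hits m n A u y + (ind ((δ <ᵇ D u + (m + n)) ∧ (D u ≤ᵇ δ + n)) + ind (δ + n <ᵇ D u))
      ≡⟨ cong (hits m n A u y +_) (boundary m n (D u) δ) ⟩
    hits m n A u y + (_ + ind (L <ᵇ D u))
      ≡⟨ +-assoc (hits m n A u y) _ _ ⟨
    hits m n A u y + _ + ind (L <ᵇ D u)
      ≡⟨ cong (λ z → hits m n A u y + z + ind (L <ᵇ D u)) attack≡ ⟨
    hits m n A u y + attack (m + n) n B u y + ind (L <ᵇ D u) ∎
    where
    open ≡-Reasoning
    u<n = <-trans u<y y<n
    1+u<n = ≤-<-trans u<y y<n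
    δ = D y
    L = δ + (m + n)
    g = A (suc u) ∸ A u
    w = m * suc u
    extra = count g (λ t → within (L + n * (A u + t)) (n + L + n * (A u + t)) w)

    Au≤ : A u ≤ A (suc u)
    Au≤ = Dyck.mono path 1+u<n

    width : B (suc u) ∸ B u ≡ 1 + g
    width rewrite shear 1+u<n | shear u<n | +-suc (A (suc u)) u = trans (+-∸-assoc 1 (+-monoˡ-≤ u Au≤))
      (cong suc (trans (cong₂ _∸_ (+-comm (A (suc u)) u) (+-comm (A u) u)) ([m+n]∸[m+o]≡n∸o u (A (suc u)) (A u))))

    -- By the gap equation of row `u`, the sheared run starts at height `D u + (m + n)`.
    first : hit (m + n) n δ u (A u + u + 0) ≡ (δ <ᵇ D u + (m + n)) ∧ (D u ≤ᵇ δ + n)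
    first = cong₂ _∧_
      (<ᵇ-shift δ (D u + (m + n)) 0 (n * A u + n * u) (e₁ δ n (A u) u) (trans (e₂ m n u) (trans (cong (_+ (m + n * u + n)) (sym (gap-≡ path u<n))) (e₃ m n (A u) u (D u)))))
      (≤ᵇ-shift (D u) (δ + n) 0 (n * A u + n * u + (m + n)) (trans (e₂ m n u) (trans (cong (_+ (m + n * u + n)) (sym (gap-≡ path u<n))) (e₄ m n (A u) u (D u)))) (e₅ m n (A u) u δ))
      where
      e₁ : ∀ δ n a u → δ + n * (a + u + 0) + 0 ≡ δ + (n * a + n * u)
      e₁ = solve 4 (λ δ n a u → δ :+ n :* (a :+ u :+ con 0) :+ con 0 := δ :+ (n :* a :+ n :* u)) refl
      e₂ : ∀ m n u → (m + n) * suc u + 0 ≡ m * u + (m + n * u + n)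
      e₂ = solve 3 (λ m n u → (m :+ n) :* (one :+ u) :+ con 0 := m :* u :+ (m :+ n :* u :+ n)) refl
      e₃ : ∀ m n a u d → n * a + d + (m + n * u + n) ≡ d + (m + n) + (n * a + n * u)
      e₃ = solve 5 (λ m n a u d → n :* a :+ d :+ (m :+ n :* u :+ n) := d :+ (m :+ n) :+ (n :* a :+ n :* u)) refl
      e₄ : ∀ m n a u d → n * a + d + (m + n * u + n) ≡ d + (n * a + n * u + (m + n))
      e₄ = solve 5 (λ m n a u d → n :* a :+ d :+ (m :+ n :* u :+ n) := d :+ (n :* a :+ n :* u :+ (m :+ n))) refl
      e₅ : ∀ m n a u δ → δ + n + (m + n) + n * (a + u + 0) + 0 ≡ δ + n + (n * a + n * u + (m + n))
      e₅ = solve 5 (λ m n a u δ → δ :+ n :+ (m :+ n) :+ n :* (a :+ u :+ con 0) :+ con 0 := δ :+ n :+ (n :* a :+ n :* u :+ (m :+ n))) refl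

    -- Cell `suc t` of the longer run matches cell `t` of the old one. The lower end of its window
    -- is unchanged and the upper end rises by `n`; `within-split` separates off the added piece.
    rest : count g (λ t → hit (m + n) n δ u (A u + u + suc t)) ≡ hits m n A u y + extra
    rest = begin
      count g (λ t → hit (m + n) n δ u (A u + u + suc t))
        ≡⟨ count-cong g (λ {t} _ → shifted t) ⟩
      count g (λ t → within (δ + n * (A u + t)) (n + L + n * (A u + t)) w)
        ≡⟨ count-sum g _ ⟩
      sumBelow g (λ t → ind (within (δ + n * (A u + t)) (n + L + n * (A u + t)) w))
        ≡⟨ sum-cong g (λ {t} _ → trans (within-split w (lower t) (+-monoˡ-≤ (n * (A u + t)) (m≤n+m L n)))
             (cong (λ z → ind (within (δ + n * (A u + t)) z w) + ind (within (L + n * (A u + t)) (n + L + n * (A u + t)) w))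
                   (cong (_+ n * (A u + t)) (trans (cong (δ +_) (+-comm m n)) (sym (+-assoc δ n m)))))) ⟩
      sumBelow g (λ t → ind (hit m n δ u (A u + t)) + ind (within (L + n * (A u + t)) (n + L + n * (A u + t)) w))
        ≡⟨ sum-distrib-+ g _ _ ⟩
      sumBelow g (λ t → ind (hit m n δ u (A u + t))) + sumBelow g (λ t → ind (within (L + n * (A u + t)) (n + L + n * (A u + t)) w))
        ≡⟨ cong₂ _+_ (count-sum g _) (count-sum g _) ⟨
      hits m n A u y + extra ∎
      where
      lower : ∀ t → δ + n * (A u + t) ≤ L + n * (A u + t)
      lower t = +-monoˡ-≤ (n * (A u + t)) (m≤m+n δ (m + n))
      e₁ : ∀ δ n a u t → δ + n * (a + u + suc t) + 0 ≡ δ + n * (a + t) + (n * u + n)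
      e₁ = solve 5 (λ δ n a u t → δ :+ n :* (a :+ u :+ (one :+ t)) :+ con 0 := δ :+ n :* (a :+ t) :+ (n :* u :+ n)) refl
      e₂ : ∀ m n u → (m + n) * suc u + 0 ≡ m * suc u + (n * u + n)
      e₂ = solve 3 (λ m n u → (m :+ n) :* (one :+ u) :+ con 0 := m :* (one :+ u) :+ (n :* u :+ n)) refl
      e₃ : ∀ m n a u δ t → δ + n + (m + n) + n * (a + u + suc t) + 0 ≡ n + (δ + (m + n)) + n * (a + t) + (n * u + n)
      e₃ = solve 6 (λ m n a u δ t → δ :+ n :+ (m :+ n) :+ n :* (a :+ u :+ (one :+ t)) :+ con 0
                                   := n :+ (δ :+ (m :+ n)) :+ n :* (a :+ t) :+ (n :* u :+ n)) refl
      shifted : ∀ t → hit (m + n) n δ u (A u + u + suc t) ≡ within (δ + n * (A u + t)) (n + L + n * (A u + t)) w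
      shifted t = cong₂ _∧_
        (<ᵇ-shift (δ + n * (A u + t)) w 0 (n * u + n) (e₁ δ n (A u) u t) (e₂ m n u))
        (≤ᵇ-shift w (n + L + n * (A u + t)) 0 (n * u + n) (e₂ m n u) (e₃ m n (A u) u δ t))

    -- The telescoping sum runs from column `A u`, where the run has height `D u + m`, to column
    -- `A (suc u)`, where it has height `D (suc u)`.
    extra-≡ : extra + ind (L <ᵇ D (suc u)) ≡ ind (δ + n <ᵇ D u)
    extra-≡ = begin
      extra + ind (L <ᵇ D (suc u))
        ≡⟨ cong (λ z → extra + ind z) (<ᵇ-shift (L + n * (A u + g)) w (n * A (suc u)) 0
             (trans (cong (λ z → L + n * z) (sym (m+[n∸m]≡n Au≤))) (sym (+-identityʳ _)))
             (trans (+-comm (D (suc u)) _) (trans (gap-≡ path 1+u<n) (sym (+-identityʳ _))))) ⟩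
      extra + ind (L + n * (A u + g) <ᵇ w)
        ≡⟨ count-telescope L n w (A u) g ⟩
      ind (L + n * A u <ᵇ w)
        ≡⟨ cong ind (<ᵇ-shift (δ + n) (D u) 0 (m + n * A u) (e₁ δ m n (n * A u))
             (trans (e₂ m u) (trans (cong (_+ m) (sym (gap-≡ path u<n))) (e₃ m (n * A u) (D u))))) ⟩
      ind (δ + n <ᵇ D u) ∎
      where
      e₁ : ∀ δ m n a → δ + (m + n) + a + 0 ≡ δ + n + (m + a)
      e₁ = solve 4 (λ δ m n a → δ :+ (m :+ n) :+ a :+ con 0 := δ :+ n :+ (m :+ a)) refl
      e₂ : ∀ m u → m * suc u + 0 ≡ m * u + m
      e₂ = solve 2 (λ m u → m :* (one :+ u) :+ con 0 := m :* u :+ m) refl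
      e₃ : ∀ m a d → a + d + m ≡ d + (m + a)
      e₃ = solve 3 (λ m a d → a :+ d :+ m := d :+ (m :+ a)) refl

    arrange : ∀ a h x z → a + (h + x) + z ≡ h + (a + (x + z))
    arrange = solve 4 (λ a h x z → a :+ (h :+ x) :+ z := h :+ (a :+ (x :+ z))) refl

    attack≡ : attack (m + n) n B u y ≡
      ind ((D u ≤ᵇ δ) ∧ (δ <ᵇ D u + (m + n))) + ind ((δ <ᵇ D u) ∧ (D u ≤ᵇ δ + (m + n)))
    attack≡ = trans (attack-gaps dyck-shear u<y y<n)
      (cong₂ (λ e d → ind ((e ≤ᵇ d) ∧ (d <ᵇ e + (m + n))) + ind ((d <ᵇ e) ∧ (e ≤ᵇ d + (m + n))))
        (gap-shear u<n) (gap-shear y<n))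

  triangle-hits-shear : triangle n (hits (m + n) n B) ≡ triangle n (hits m n A) + triangle n (attack (m + n) n B)
  triangle-hits-shear = trans (sum-cong n row) (sum-distrib-+ n _ _)
    where
    open ≡-Reasoning
    row : ∀ {y} → y < n → sumBelow y (λ u → hits (m + n) n B u y)
                        ≡ sumBelow y (λ u → hits m n A u y) + sumBelow y (λ u → attack (m + n) n B u y)
    row {y} y<n = +-cancelʳ-≡ (sumBelow y F) _ _ (begin
      sumBelow y (λ u → hits (m + n) n B u y) + sumBelow y F
        ≡⟨ cong (sumBelow y (λ u → hits (m + n) n B u y) +_) F-shift ⟩
      sumBelow y (λ u → hits (m + n) n B u y) + sumBelow y (F ∘ suc)
        ≡⟨ sum-distrib-+ y _ _ ⟨
      sumBelow y (λ u → hits (m + n) n B u y + F (suc u))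
        ≡⟨ sum-cong y (λ u<y → hits-shear u<y y<n) ⟩
      sumBelow y (λ u → hits m n A u y + attack (m + n) n B u y + F u)
        ≡⟨ sum-distrib-+ y _ _ ⟩
      sumBelow y (λ u → hits m n A u y + attack (m + n) n B u y) + sumBelow y F
        ≡⟨ cong (_+ sumBelow y F) (sum-distrib-+ y _ _) ⟩
      _ ∎)
      where
      -- `F` vanishes at both ends, as row 0 has gap 0 and `D y` does not exceed itself. Its sums
      -- over `0 ≤ u < y` and over `1 ≤ u ≤ y` therefore agree.
      F : ℕ → ℕ
      F u = ind (D y + (m + n) <ᵇ D u)
      F0 : F 0 ≡ 0
      F0 = cong ind (≥⇒<ᵇ-false (≤-trans (≤-reflexive (trans (cong (_∸ n * A 0) (*-zeroʳ m)) (0∸n≡0 (n * A 0)))) z≤n))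
      Fy : F y ≡ 0
      Fy = cong ind (≥⇒<ᵇ-false (m≤m+n (D y) (m + n)))
      F-shift : sumBelow y F ≡ sumBelow y (F ∘ suc)
      F-shift = begin
        sumBelow y F       ≡⟨ +-identityʳ _ ⟨
        sumBelow y F + 0   ≡⟨ cong (sumBelow y F +_) Fy ⟨
        sumBelow y F + F y ≡⟨ sum-head y F ⟩
        F 0 + sumBelow y (F ∘ suc) ≡⟨ cong (_+ sumBelow y (F ∘ suc)) F0 ⟩
        sumBelow y (F ∘ suc) ∎

-- Entries of vectors and reversed indices

at-tabulate : ∀ {n} (g : ℕ → ℕ) {i} → i < n → at (tabulate {n = n} (g ∘ toℕ)) i 0 ≡ g i
at-tabulate {suc n} g {zero}  _   = refl
at-tabulate {suc n} g {suc i} i<n = at-tabulate (g ∘ suc) (s≤s⁻¹ i<n)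

at-zipWith-+ : ∀ {n} (u v : Vec ℕ n) i → at (zipWith _+_ u v) i 0 ≡ at u i 0 + at v i 0
at-zipWith-+ []      []      i       = refl
at-zipWith-+ (x ∷ u) (y ∷ v) zero    = refl
at-zipWith-+ (x ∷ u) (y ∷ v) (suc i) = at-zipWith-+ u v i

at-ext : ∀ {n} {u v : Vec ℕ n} → (∀ {i} → i < n → at u i 0 ≡ at v i 0) → u ≡ v
at-ext {u = []}    {[]}    h = refl
at-ext {u = x ∷ u} {y ∷ v} h = cong₂ _∷_ (h z<s) (at-ext (λ i<n → h (s≤s i<n)))

∸-flip-injective : ∀ {n i j} → i < n → j < n → n ∸ suc i ≡ n ∸ suc j → i ≡ j
∸-flip-injective {n} i<n j<n eq =
  trans (sym (∸-flip i<n)) (trans (cong (λ z → n ∸ suc z) eq) (∸-flip j<n))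

Permutes-reverse : ∀ {n p} → Permutes n p → ∀ {q} → (∀ {i} → i < n → q i ≡ p (n ∸ suc i)) → Permutes n q
Permutes-reverse {n} perm q≡ = record
  { bounded   = λ i<n → subst (_< n) (sym (q≡ i<n)) (bounded (∸-flip-< i<n))
  ; injective = λ i<n j<n eq → ∸-flip-injective i<n j<n
      (injective (∸-flip-< i<n) (∸-flip-< j<n) (trans (sym (q≡ i<n)) (trans eq (q≡ j<n))))
  }
  where open Permutes perm

triangle-mono : ∀ n {g h} → (∀ {u v} → u < v → v < n → g u v ≤ h u v) → triangle n g ≤ triangle n h
triangle-mono n f = sum-mono n λ {v} v<n → sum-mono v λ u<v → f u<v v<n

triangle-cong : ∀ n {g h} → (∀ {u v} → u < v → v < n → g u v ≡ h u v) → triangle n g ≡ triangle n h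
triangle-cong n f = sum-cong n λ {v} v<n → sum-cong v λ u<v → f u<v v<n

-- Maxima over enumerated labellings

maximum-filter : ∀ {A : Set} (f : A → ℕ) p xs {x M} → x ∈ xs → T (p x) → f x ≡ M →
                 (∀ y → T (p y) → f y ≤ M) → maximum (map f (filterB p xs)) ≡ M
maximum-filter f p xs {x} {M} x∈xs px fx≡M bound = ≤-antisym (upper xs) (subst (_≤ _) fx≡M (lower xs x∈xs))
  where
  upper : ∀ xs → maximum (map f (filterB p xs)) ≤ M
  upper [] = z≤n
  upper (y ∷ xs) with p y in eq
  ... | true  = ⊔-lub (bound y (subst T (sym eq) _)) (upper xs)
  ... | false = upper xs
  lower : ∀ xs → x ∈ xs → f x ≤ maximum (map f (filterB p xs))
  lower (y ∷ xs) x∈ with p y in eq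
  lower (y ∷ xs) (here refl)  | true  = m≤m⊔n _ _
  lower (y ∷ xs) (there x∈xs) | true  = ≤-trans (lower xs x∈xs) (m≤n⊔m _ _)
  lower (y ∷ xs) (here refl)  | false = ⊥-elim (subst T eq px)
  lower (y ∷ xs) (there x∈xs) | false = lower xs x∈xs

∈-allVecs : ∀ {k b} (v : Vec ℕ k) → (∀ {i} → i < k → at v i 0 < b) → v ∈ allVecs k b
∈-allVecs         []      h = here refl
∈-allVecs {suc k} {b} (x ∷ v) h = ∈-concatMap⁺ (λ y → map (y ∷_) (allVecs k b))
  (lose (∈-upTo⁺ (h z<s)) (∈-map⁺ (x ∷_) (∈-allVecs v (λ i<k → h (s≤s i<k)))))

-- Decoding the boolean predicates

isPath⁻ : ∀ {m n} (a : Vec ℕ n) → T (isPath m n a) → Dyck m n (λ y → at a y 0)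
isPath⁻ a t = record
  { mono  = λ y< → ≤ᵇ⇒≤ _ _ (proj₁ (T-∧⁻ (allBelow⁻ t y<)))
  ; above = λ {y} y< → ≤ᵇ⇒≤ _ _ (proj₂ (T-∧⁻ {at a y 0 ≤ᵇ _} (proj₂ (T-∧⁻ {(y ≡ᵇ 0) ∨ (at a (y ∸ 1) 0 ≤ᵇ at a y 0)} (allBelow⁻ t y<)))))
  }

isPath⁺ : ∀ {m n} .{{_ : NonZero m}} (a : Vec ℕ n) → Dyck m n (λ y → at a y 0) → T (isPath m n a)
isPath⁺ {m} {n} a path = allBelow⁺ {n} λ {y} y<n →
  T-∧⁺ (monotone y y<n) (T-∧⁺ (≤⇒≤ᵇ (<⇒≤ (column<m path y<n))) (≤⇒≤ᵇ (Dyck.above path y<n)))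
  where
  monotone : ∀ y → y < n → T ((y ≡ᵇ 0) ∨ (at a (y ∸ 1) 0 ≤ᵇ at a y 0))
  monotone zero    _   = _
  monotone (suc y) y<n = ≤⇒≤ᵇ (Dyck.mono path y<n)

record Labelling (n : ℕ) (A r : ℕ → ℕ) : Set where
  field
    permutes : Permutes n r
    column   : ∀ {i j} → i < j → j < n → A (r i) ≡ A (r j) → r i < r j

isLabelling⁻ : ∀ {n} (a r : Vec ℕ n) → T (isLabelling n a r) → Labelling n (λ y → at a y 0) (λ c → at r c 0)
isLabelling⁻ {n} a r t = record
  { permutes = record
    { bounded   = λ i<n → <ᵇ⇒< _ _ (allBelow⁻ (proj₁ (T-∧⁻ t)) i<n)
    ; injective = inj }
  ; column = λ {i} {j} i<j j<n eq → col i j (proj₂ (T-∧⁻ {not (at r i 0 ≡ᵇ at r j 0)} (pair i<j j<n))) eq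
  }
  where
  pair : ∀ {i j} → i < j → j < n → T (not (at r i 0 ≡ᵇ at r j 0)
           ∧ (not (at a (at r i 0) 0 ≡ᵇ at a (at r j 0) 0) ∨ (at r i 0 <ᵇ at r j 0)))
  pair i<j j<n = allBelow⁻ (allBelow⁻ (proj₂ (T-∧⁻ {allBelow n (λ c → at r c 0 <ᵇ n)} t)) j<n) i<j
  distinct : ∀ {i j} → i < j → j < n → at r i 0 ≢ at r j 0
  distinct i<j j<n eq = T-not⁻ (proj₁ (T-∧⁻ (pair i<j j<n))) (≡⇒≡ᵇ _ _ eq)
  inj : ∀ {i j} → i < n → j < n → at r i 0 ≡ at r j 0 → i ≡ j
  inj {i} {j} i<n j<n eq with <-cmp i j
  ... | tri< i<j _ _ = ⊥-elim (distinct i<j j<n eq)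
  ... | tri≈ _ i≡j _ = i≡j
  ... | tri> _ _ j<i = ⊥-elim (distinct j<i i<n (sym eq))
  col : ∀ i j → T (not (at a (at r i 0) 0 ≡ᵇ at a (at r j 0) 0) ∨ (at r i 0 <ᵇ at r j 0)) →
        at a (at r i 0) 0 ≡ at a (at r j 0) 0 → at r i 0 < at r j 0
  col i j s eq with Equivalence.to (T-∨ {not (at a (at r i 0) 0 ≡ᵇ at a (at r j 0) 0)}) s
  ... | inj₁ ne = ⊥-elim (T-not⁻ ne (≡⇒≡ᵇ _ _ eq))
  ... | inj₂ lt = <ᵇ⇒< _ _ lt

isLabelling⁺ : ∀ {n} (a r : Vec ℕ n) → Labelling n (λ y → at a y 0) (λ c → at r c 0) → T (isLabelling n a r)
isLabelling⁺ {n} a r lab = T-∧⁺ (allBelow⁺ {n} (λ i<n → <⇒<ᵇ (bounded i<n)))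
  (allBelow⁺ {n} λ {j} j<n → allBelow⁺ {j} λ {i} i<j → T-∧⁺
    (T-not⁺ (λ e → <⇒≢ i<j (injective (<-trans i<j j<n) j<n (≡ᵇ⇒≡ _ _ e))))
    (col i<j j<n))
  where
  open Labelling lab
  open Permutes permutes
  col : ∀ {i j} → i < j → j < n → T (not (at a (at r i 0) 0 ≡ᵇ at a (at r j 0) 0) ∨ (at r i 0 <ᵇ at r j 0))
  col {i} {j} i<j j<n with at a (at r i 0) 0 ≡ᵇ at a (at r j 0) 0 in eq
  ... | false = _
  ... | true  = <⇒<ᵇ (column i<j j<n (≡ᵇ⇒≡ _ _ (subst T (sym eq) _)))

-- Words, `tdinv` and `maxdinv` counted over rows

<ℤ-+ : ∀ x y → (pos x <ℤ pos y) ≡ (x <ᵇ y)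
<ℤ-+ x y = T-ext (λ t → <⇒<ᵇ (ℤ.drop‿+<+ (toWitness t))) (λ t → fromWitness (ℤ.+<+ (<ᵇ⇒< x y t)))

-- The word position of the car in row `v`, counted over rows and so independent of the labelling.
outranked : (m n : ℕ) → (ℕ → ℕ) → ℕ → ℕ
outranked m n A v = count n λ u → rank m n A v <ᵇ rank m n A u

-- If `u` did not outrank `v`, every row outranking `v` would outrank `u` as well.
outranked-reflects-< : ∀ {m n A u v} → outranked m n A u < outranked m n A v → rank m n A v < rank m n A u
outranked-reflects-< {m} {n} {A} {u} {v} p = ≰⇒> λ q → <⇒≱ p
  (subst₂ _≤_ (sym (count-sum n _)) (sym (count-sum n _))
    (sum-mono n λ {w} _ → ind-mono λ t → <⇒<ᵇ (≤-<-trans q (<ᵇ⇒< (rank m n A v) (rank m n A w) t))))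

module _ {m n : ℕ} (a r : Vec ℕ n) (path : Dyck m n (λ y → at a y 0)) where
  private
    A = λ y → at a y 0
    R = rank m n A

  carRank-+ : ∀ {c} → at r c 0 < n → carRank m n (a , r) c ≡ pos (R (at r c 0))
  carRank-+ {c} y<n = cong (ℤ._+ pos (shift m n (A y)))
    (trans (ℤ.m-n≡m⊖n (m * y) (n * A y)) (ℤ.⊖-≥ (Dyck.above path y<n)))
    where y = at r c 0

  module _ (perm : Permutes n (λ c → at r c 0)) where
    open Permutes perm

    wordPos-outranked : ∀ {c} → c < n → wordPos m n (a , r) c ≡ outranked m n A (at r c 0)
    wordPos-outranked {c} c<n = begin
      wordPos m n (a , r) c
        ≡⟨ count-cong n (λ {c′} c′<n → trans (cong₂ _<ℤ_ (carRank-+ {c} (bounded c<n)) (carRank-+ {c′} (bounded c′<n))) (<ℤ-+ _ _)) ⟩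
      count n (λ c′ → R (at r c 0) <ᵇ R (at r c′ 0))
        ≡⟨ count-sum n _ ⟩
      sumBelow n (λ c′ → ind (R (at r c 0) <ᵇ R (at r c′ 0)))
        ≡⟨ sum-permute perm (λ u → ind (R (at r c 0) <ᵇ R u)) ⟩
      sumBelow n (λ u → ind (R (at r c 0) <ᵇ R u))
        ≡⟨ count-sum n _ ⟨
      outranked m n A (at r c 0) ∎
      where open ≡-Reasoning

    tdinv-windows : tdinv m n (a , r) ≡ triangle n (λ i j → ind (window m n A (at r i 0) (at r j 0)))
    tdinv-windows = sum-cong n λ {j} j<n → trans
      (count-cong j λ {i} i<j → cong₂ _∧_
        (trans (cong₂ _<ℤ_ (ranks (<-trans i<j j<n)) (ranks j<n)) (<ℤ-+ _ _))
        (trans (cong₂ (λ x y → y <ℤ (x ℤ.+ pos m)) (ranks (<-trans i<j j<n)) (ranks j<n)) (<ℤ-+ _ _)))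
      (count-sum j _)
      where
      ranks : ∀ {c} → c < n → carRank m n (a , r) c ≡ pos (R (at r c 0))
      ranks {c} c<n = carRank-+ {c} (bounded c<n)

    -- Each pair of cars contributes at most its `attack`, and the total of `attack` does not depend
    -- on the labelling.
    tdinv-≤ : tdinv m n (a , r) ≤ triangle n (attack m n A)
    tdinv-≤ = begin
      tdinv m n (a , r)
        ≡⟨ tdinv-windows ⟩
      triangle n (λ i j → ind (window m n A (at r i 0) (at r j 0)))
        ≤⟨ triangle-mono n (λ _ _ → m≤m+n _ _) ⟩
      triangle n (λ i j → attack m n A (at r i 0) (at r j 0))
        ≡⟨ triangle-permute perm (attack m n A) (attack-sym m n A) (attack-diag m n A) ⟩
      triangle n (attack m n A) ∎
      where open ≤-Reasoning

    -- When ranks increase with the labels the window in the opposite order is always empty, so the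
    -- bound of `tdinv-≤` is attained.
    tdinv-increasing : (∀ {i j} → i < j → j < n → R (at r i 0) < R (at r j 0)) →
                       tdinv m n (a , r) ≡ triangle n (attack m n A)
    tdinv-increasing inc = begin
      tdinv m n (a , r)
        ≡⟨ tdinv-windows ⟩
      triangle n (λ i j → ind (window m n A (at r i 0) (at r j 0)))
        ≡⟨ triangle-cong n (λ {i} {j} i<j j<n → trans (sym (+-identityʳ _))
             (cong (λ b → ind (window m n A (at r i 0) (at r j 0)) + ind (b ∧ (R (at r i 0) <ᵇ R (at r j 0) + m)))
                   (sym (≥⇒<ᵇ-false (<⇒≤ (inc i<j j<n)))))) ⟩
      triangle n (λ i j → attack m n A (at r i 0) (at r j 0))
        ≡⟨ triangle-permute perm (attack m n A) (attack-sym m n A) (attack-diag m n A) ⟩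
      triangle n (attack m n A) ∎
      where open ≡-Reasoning

    tdinv-decreasing : (∀ {i j} → i < j → j < n → R (at r j 0) < R (at r i 0)) → tdinv m n (a , r) ≡ 0
    tdinv-decreasing dec = trans tdinv-windows (sum-zero n λ {j} j<n → sum-zero j λ {i} i<j →
      cong (λ b → ind (b ∧ (R (at r j 0) <ᵇ R (at r i 0) + m))) (≥⇒<ᵇ-false (<⇒≤ (dec i<j j<n))))

-- The given labelling attains the bound that `tdinv-≤` imposes on all labellings, and its validity
-- on the path places it among the enumerated candidates.
maxdinv-attacks : ∀ {m n} (a r : Vec ℕ n) → Dyck m n (λ y → at a y 0) →
  Labelling n (λ y → at a y 0) (λ c → at r c 0) →
  (∀ {i j} → i < j → j < n → rank m n (λ y → at a y 0) (at r i 0) < rank m n (λ y → at a y 0) (at r j 0)) →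
  maxdinv m n a ≡ triangle n (attack m n (λ y → at a y 0))
maxdinv-attacks {m} {n} a r path lab inc = maximum-filter (λ s → tdinv m n (a , s)) (isLabelling n a) (allVecs n n)
  (∈-allVecs r (Permutes.bounded permutes)) (isLabelling⁺ a r lab) (tdinv-increasing a r path permutes inc)
  (λ s t → tdinv-≤ a s path (Labelling.permutes (isLabelling⁻ a s t)))
  where open Labelling lab

-- Parking functions with a prescribed word

record Parking (m n : ℕ) (π : Raw n) (word : ℕ → ℕ) : Set where
  field
    path      : Dyck m n (λ y → at (proj₁ π) y 0)
    labelling : Labelling n (λ y → at (proj₁ π) y 0) (λ c → at (proj₂ π) c 0)
    position  : ∀ {c} → c < n → outranked m n (λ y → at (proj₁ π) y 0) (at (proj₂ π) c 0) ≡ word c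
  open Labelling labelling public
  open Permutes permutes public

-- hasWord reads word k as the car in position k, the record as the position of car k.
parking⁻ : ∀ {m n} π w {word} → (∀ {k} → k < n → at w k 0 ≡ word k × word k < n × word (word k) ≡ k) →
           T (isPF m n π ∧ hasWord m n π w) → Parking m n π word
parking⁻ {m} {n} π@(a , r) w {word} inv t = record
  { path = path ; labelling = lab
  -- The word is an involution: the car listed in position `word c` is `word (word c)`, which is
  -- `c`.
  ; position = λ {c} c<n → let (_ , wc<n , wwc) = inv c<n; (at≡ , _ , _) = inv wc<n in
      trans (sym (wordPos-outranked a r path (Labelling.permutes lab) c<n))
        (trans (cong (wordPos m n π) (sym (trans at≡ wwc)))
               (≡ᵇ⇒≡ _ _ (allBelow⁻ (proj₂ (T-∧⁻ {isPF m n π} t)) wc<n)))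
  }
  where
  pf = T-∧⁻ {isPath m n a} (proj₁ (T-∧⁻ {isPF m n π} t))
  path = isPath⁻ a (proj₁ pf)
  lab = isLabelling⁻ a r (proj₂ pf)

parking⁺ : ∀ {m n} .{{_ : NonZero m}} π w {word} →
           (∀ {k} → k < n → at w k 0 ≡ word k × word k < n × word (word k) ≡ k) →
           Parking m n π word → T (isPF m n π ∧ hasWord m n π w)
parking⁺ {m} {n} π@(a , r) w inv p = T-∧⁺ (T-∧⁺ (isPath⁺ a path) (isLabelling⁺ a r labelling))
  (allBelow⁺ {n} λ {k} k<n → let (at≡ , wk<n , wwk) = inv k<n in ≡⇒≡ᵇ _ _
    (trans (cong (wordPos m n π) at≡) (trans (wordPos-outranked a r path permutes wk<n) (trans (position wk<n) wwk))))
  where open Parking p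

decWord-inv : ∀ {n k} → k < n → at (decWord n) k 0 ≡ n ∸ suc k × n ∸ suc k < n × n ∸ suc (n ∸ suc k) ≡ k
decWord-inv {n} k<n = at-tabulate (λ k → n ∸ suc k) k<n , ∸-flip-< k<n , ∸-flip k<n

incWord-inv : ∀ {n k} → k < n → at (incWord n) k 0 ≡ k × k < n × k ≡ k
incWord-inv k<n = at-tabulate id k<n , k<n , refl

-- Area and diagonal points under the shear

area-shear : ∀ {m n} (a b r s : Vec ℕ n) → (∀ {y} → y < n → at b y 0 ≡ at a y 0 + y) →
             area (m + n) n (b , s) ≡ area m n (a , r)
area-shear {m} {n} a b r s shear = sum-cong n λ {y} y<n → row y y<n
  where
  open ≡-Reasoning
  row : ∀ y → y < n → count (m + n) (λ x → (at b y 0 ≤ᵇ x) ∧ (n * suc x ≤ᵇ (m + n) * y))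
                    ≡ count m (λ x → (at a y 0 ≤ᵇ x) ∧ (n * suc x ≤ᵇ m * y))
  -- The first `y` columns lie left of the sheared path and the last `n ∸ y` fail the diagonal
  -- condition. In the `m` columns between, `y + x` corresponds to the old column `x`.
  row y y<n rewrite shear y<n = begin
    count (m + n) p
      ≡⟨ cong (λ k → count k p) width ⟩
    count (y + (m + (n ∸ y))) p
      ≡⟨ count-++ y (m + (n ∸ y)) p ⟩
    count y p + count (m + (n ∸ y)) (λ x → p (y + x))
      ≡⟨ cong (_+ count (m + (n ∸ y)) (λ x → p (y + x))) (count-zero y λ {x} x<y → cong (_∧ (n * suc x ≤ᵇ (m + n) * y))
           (>⇒≤ᵇ-false (<-≤-trans x<y (m≤n+m y A)))) ⟩
    count (m + (n ∸ y)) (λ x → p (y + x))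
      ≡⟨ count-++ m (n ∸ y) _ ⟩
    count m (λ x → p (y + x)) + count (n ∸ y) (λ i → p (y + (m + i)))
      ≡⟨ cong₂ _+_ (count-cong m λ {x} _ → cong₂ _∧_
             (≤ᵇ-shift A x 0 y (+-identityʳ (A + y)) (trans (+-identityʳ (y + x)) (+-comm y x)))
             (≤ᵇ-shift (n * suc x) (m * y) 0 (n * y) (e₁ n x y) (e₂ m n y)))
           (count-zero (n ∸ y) λ {i} _ → trans (cong ((A + y ≤ᵇ y + (m + i)) ∧_) (>⇒≤ᵇ-false (beyond i))) (∧-zeroʳ _)) ⟩
    count m (λ x → (A ≤ᵇ x) ∧ (n * suc x ≤ᵇ m * y)) + 0
      ≡⟨ +-identityʳ _ ⟩
    count m (λ x → (A ≤ᵇ x) ∧ (n * suc x ≤ᵇ m * y)) ∎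
    where
    A = at a y 0
    p : ℕ → Bool
    p x = (A + y ≤ᵇ x) ∧ (n * suc x ≤ᵇ (m + n) * y)
    width : m + n ≡ y + (m + (n ∸ y))
    width = trans (cong (m +_) (sym (m+[n∸m]≡n (<⇒≤ y<n)))) (e₀ m y (n ∸ y))
      where
      e₀ : ∀ m y k → m + (y + k) ≡ y + (m + k)
      e₀ = solve 3 (λ m y k → m :+ (y :+ k) := y :+ (m :+ k)) refl
    e₁ : ∀ n x y → n * suc (y + x) + 0 ≡ n * suc x + n * y
    e₁ = solve 3 (λ n x y → n :* (one :+ (y :+ x)) :+ con 0 := n :* (one :+ x) :+ n :* y) refl
    e₂ : ∀ m n y → (m + n) * y + 0 ≡ m * y + n * y
    e₂ = solve 3 (λ m n y → (m :+ n) :* y :+ con 0 := m :* y :+ n :* y) refl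
    beyond : ∀ i → (m + n) * y < n * suc (y + (m + i))
    beyond i = ≤-<-trans (≤-reflexive (*-distribʳ-+ y m n)) (≤-<-trans
      (+-monoˡ-≤ (n * y) (≤-trans (*-monoʳ-≤ m (<⇒≤ y<n)) (≤-reflexive (*-comm m n))))
      (<-≤-trans (≤-<-trans (≤-reflexive (trans (sym (*-distribˡ-+ n m y)) (cong (n *_) (+-comm m y))))
        (*-monoʳ-< n {{>-nonZero (≤-<-trans z≤n y<n)}} (n<1+n (y + m))))
        (*-monoʳ-≤ n (s≤s (+-monoʳ-≤ y (m≤m+n m i))))))

-- At a diagonal point the condition a_{Y-1} ≤ X is automatic.
onPath-diagonal : ∀ {m n} .{{_ : NonZero m}} (a : Vec ℕ n) → Dyck m n (λ y → at a y 0) → ∀ {X Y} → Y ≤ n → n * X ≡ m * Y →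
                  onPath m n a X Y ≡ (X ≤ᵇ (if Y <ᵇ n then at a Y 0 else m))
onPath-diagonal {m} {n} a path {X} {zero}  Y≤n eq = refl
onPath-diagonal {m} {n} a path {X} {suc y} y<n eq
  rewrite <⇒<ᵇ-true y<n
        | ≤⇒≤ᵇ-true (<⇒≤ (*-cancelˡ-< n (at a y 0) X (≤-<-trans (Dyck.above path y<n)
            (<-≤-trans (*-monoʳ-< m (n<1+n y)) (≤-reflexive (sym eq)))))) = refl

search-cong : ∀ f s {p q} d → (∀ i → p i ≡ q i) → search f s p d ≡ search f s q d
search-cong zero    s d h = refl
search-cong (suc f) s d h rewrite h s | search-cong f (suc s) d h = refl

gcd-+ˡ : ∀ m n → gcd (m + n) n ≡ gcd m n
gcd-+ˡ m n = ∣-antisym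
  (gcd-greatest (∣m+n∣m⇒∣n (subst (gcd (m + n) n ∣_) (+-comm m n) (gcd[m,n]∣m (m + n) n)) (gcd[m,n]∣n (m + n) n))
                (gcd[m,n]∣n (m + n) n))
  (gcd-greatest (∣m∣n⇒∣m+n (gcd[m,n]∣m m n) (gcd[m,n]∣n m n)) (gcd[m,n]∣n m n))

fdiv-*-∣ : ∀ {k a} → 0 < k → k ∣ a → fdiv a k * k ≡ a
fdiv-*-∣ {suc k} _ = m/n*n≡m

fdiv-+-∣ : ∀ {k a} b → k ∣ a → fdiv (a + b) k ≡ fdiv a k + fdiv b k
fdiv-+-∣ {zero}  b _ = refl
fdiv-+-∣ {suc k} b p = +-distrib-/-∣ˡ b p

-- Transport of words and statistics along the shear

module Shear {m n : ℕ} .{{_ : NonZero m}} (a b : Vec ℕ n) (path : Dyck m n (λ y → at a y 0))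
             (shear : ∀ {y} → y < n → at b y 0 ≡ at a y 0 + y) where
  private
    A = λ y → at a y 0
    B = λ y → at b y 0
    instance
      m+n≢0 : NonZero (m + n)
      m+n≢0 = >-nonZero (≤-trans (>-nonZero⁻¹ m) (m≤m+n m n))

  path′ : Dyck (m + n) n B
  path′ = dyck-shear path shear

  -- The gcd is unchanged, so the same `i` index the diagonal points. The point `(X , Y)` moves to
  -- `(X + Y , Y)`, just as the path does.
  ret-shear : ∀ r s → ret (m + n) n (b , s) ≡ ret m n (a , r)
  ret-shear r s rewrite gcd-+ˡ m n = search-cong k 1 k same
    where
    k = gcd m n
    m₀ = fdiv m k
    n₀ = fdiv n k
    0<k : 0 < k
    0<k = n≢0⇒n>0 (gcd[m,n]≢0 m n (inj₁ (≢-nonZero⁻¹ m)))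
    same : ∀ i → onPath (m + n) n b (i * fdiv (m + n) k) (i * n₀) ≡ onPath m n a (i * m₀) (i * n₀)
    same i with ≤-<-connex (i * n₀) n
    ... | inj₂ n<Y rewrite >⇒≤ᵇ-false n<Y = refl
    ... | inj₁ Y≤n = begin
      onPath (m + n) n b (i * fdiv (m + n) k) Y
        ≡⟨ cong (λ x → onPath (m + n) n b x Y) (trans (cong (i *_) (fdiv-+-∣ n (gcd[m,n]∣m m n))) (*-distribˡ-+ i m₀ n₀)) ⟩
      onPath (m + n) n b (X + Y) Y
        ≡⟨ onPath-diagonal b path′ Y≤n (trans (*-distribˡ-+ n X Y) (trans (cong (_+ n * Y) diagonal) (sym (*-distribʳ-+ Y m n)))) ⟩
      (X + Y ≤ᵇ (if Y <ᵇ n then at b Y 0 else m + n))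
        ≡⟨ end (m≤n⇒m<n∨m≡n Y≤n) ⟩
      (X ≤ᵇ (if Y <ᵇ n then at a Y 0 else m))
        ≡⟨ onPath-diagonal a path Y≤n diagonal ⟨
      onPath m n a X Y ∎
      where
      open ≡-Reasoning
      X = i * m₀
      Y = i * n₀
      diagonal : n * X ≡ m * Y
      diagonal = begin
        n * (i * m₀)        ≡⟨ cong (_* (i * m₀)) (fdiv-*-∣ 0<k (gcd[m,n]∣n m n)) ⟨
        n₀ * k * (i * m₀)   ≡⟨ e n₀ k i m₀ ⟩
        m₀ * k * (i * n₀)   ≡⟨ cong (_* (i * n₀)) (fdiv-*-∣ 0<k (gcd[m,n]∣m m n)) ⟩
        m * (i * n₀)        ∎
        where
        e : ∀ n₀ k i m₀ → n₀ * k * (i * m₀) ≡ m₀ * k * (i * n₀)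
        e = solve 4 (λ n₀ k i m₀ → n₀ :* k :* (i :* m₀) := m₀ :* k :* (i :* n₀)) refl
      end : Y < n ⊎ Y ≡ n → (X + Y ≤ᵇ (if Y <ᵇ n then at b Y 0 else m + n)) ≡ (X ≤ᵇ (if Y <ᵇ n then at a Y 0 else m))
      end (inj₁ Y<n) rewrite <⇒<ᵇ-true Y<n | shear Y<n = ≤ᵇ-shift X (at a Y 0) 0 Y (+-identityʳ _) (+-identityʳ _)
      end (inj₂ Y≡n) rewrite ≥⇒<ᵇ-false (≤-reflexive (sym Y≡n)) =
        ≤ᵇ-shift X m 0 Y (+-identityʳ _) (trans (+-identityʳ _) (cong (m +_) (sym Y≡n)))

  -- Ranks may change through their floor terms, but on both paths the same comparison of gaps
  -- decides their order, and the gaps agree.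
  rank-<ᵇ-shear : ∀ {u v} → u < n → v < n →
    (rank (m + n) n B u <ᵇ rank (m + n) n B v) ≡ (rank m n A u <ᵇ rank m n A v)
  rank-<ᵇ-shear {u} {v} u<n v<n with <-cmp u v
  ... | tri≈ _ refl _ = trans (≥⇒<ᵇ-false (≤-refl {rank (m + n) n B u})) (sym (≥⇒<ᵇ-false (≤-refl {rank m n A u})))
  ... | tri< u<v _ _  = trans (rank-<⇔ path′ u<v v<n)
          (trans (cong₂ _≤ᵇ_ (gap-shear path shear u<n) (gap-shear path shear v<n)) (sym (rank-<⇔ path u<v v<n)))
  ... | tri> _ _ v<u  = trans (rank->⇔ path′ v<u u<n)
          (trans (cong₂ _<ᵇ_ (gap-shear path shear u<n) (gap-shear path shear v<n)) (sym (rank->⇔ path v<u u<n)))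

  outranked-shear : ∀ {v} → v < n → outranked (m + n) n B v ≡ outranked m n A v
  outranked-shear v<n = count-cong n (rank-<ᵇ-shear v<n)

  strict-shear : ∀ {u v} → u < v → v < n → B u < B v
  strict-shear u<v v<n rewrite shear (<-trans u<v v<n) | shear v<n = +-mono-≤-< (mono-≤ path (<⇒≤ u<v) v<n) u<v

  injective-shear : ∀ {u v} → u < n → v < n → B u ≡ B v → u ≡ v
  injective-shear {u} {v} u<n v<n eq with <-cmp u v
  ... | tri≈ _ u≡v _ = u≡v
  ... | tri< u<v _ _ = ⊥-elim (<⇒≢ (strict-shear u<v v<n) eq)
  ... | tri> _ _ v<u = ⊥-elim (<⇒≢ (strict-shear v<u u<n) (sym eq))

  labelling-shear : ∀ {r} → Permutes n r → Labelling n B r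
  labelling-shear {r} perm = record
    { permutes = perm
    ; column   = λ {i} {j} i<j j<n eq → ⊥-elim (<⇒≢ i<j (injective (<-trans i<j j<n) j<n
        (injective-shear (bounded (<-trans i<j j<n)) (bounded j<n) eq)))
    }
    where open Permutes perm

  parking-shear : ∀ {r} → Parking m n (a , r) (λ c → n ∸ suc c) → Parking (m + n) n (b , reverse r) id
  parking-shear {r} π = record
    { path      = path′
    ; labelling = labelling-shear (Permutes-reverse permutes (at-reverse r))
    ; position  = λ {c} c<n → begin
        outranked (m + n) n B (at (reverse r) c 0)   ≡⟨ cong (outranked (m + n) n B) (at-reverse r c<n) ⟩
        outranked (m + n) n B (at r (n ∸ suc c) 0)   ≡⟨ outranked-shear (bounded (∸-flip-< c<n)) ⟩
        outranked m n A (at r (n ∸ suc c) 0)         ≡⟨ position (∸-flip-< c<n) ⟩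
        n ∸ suc (n ∸ suc c)                          ≡⟨ ∸-flip c<n ⟩
        c                                            ∎
    }
    where
    open Parking π hiding (path)
    open ≡-Reasoning

  parking-unshear : ∀ {s} → Parking (m + n) n (b , s) id → Parking m n (a , reverse s) (λ c → n ∸ suc c)
  parking-unshear {s} ρ = record
    { path      = path
    ; labelling = record { permutes = perm ; column = col }
    ; position  = word
    }
    where
    open Parking ρ hiding (path)
    r = λ c → at (reverse s) c 0
    perm : Permutes n r
    perm = Permutes-reverse permutes (at-reverse s)
    word : ∀ {c} → c < n → outranked m n A (r c) ≡ n ∸ suc c
    word {c} c<n = begin
      outranked m n A (at (reverse s) c 0)          ≡⟨ cong (outranked m n A) (at-reverse s c<n) ⟩
      outranked m n A (at s (n ∸ suc c) 0)          ≡⟨ outranked-shear (bounded (∸-flip-< c<n)) ⟨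
      outranked (m + n) n B (at s (n ∸ suc c) 0)    ≡⟨ position (∸-flip-< c<n) ⟩
      n ∸ suc c                                     ∎
      where open ≡-Reasoning
    -- Within one column gaps grow upward, and ranks with them. The decreasing word gives the larger
    -- label the larger rank, so that car must sit higher.
    col : ∀ {i j} → i < j → j < n → A (r i) ≡ A (r j) → r i < r j
    col {i} {j} i<j j<n eq with <-cmp (r i) (r j)
    ... | tri< lt _ _ = lt
    ... | tri≈ _ e _  = ⊥-elim (<⇒≢ i<j (Permutes.injective perm (<-trans i<j j<n) j<n e))
    ... | tri> _ _ gt = ⊥-elim (<-asym
          (outranked-reflects-< {m} {n} {A} {r j} {r i} (subst₂ _<_ (sym (word j<n)) (sym (word (<-trans i<j j<n))) (∸-monoʳ-< (s≤s i<j) j<n)))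
          (rank-up path gt (Permutes.bounded perm (<-trans i<j j<n))
            (subst (λ x → m * r j ∸ n * A (r j) ≤ m * r i ∸ n * x) (sym eq) (∸-monoˡ-≤ (n * A (r j)) (*-monoʳ-≤ m (<⇒≤ gt))))))

  dinv-shear : ∀ {r} → Parking m n (a , r) (λ c → n ∸ suc c) →
               dinv (m + n) n (b , reverse r) ≡ dinv m n (a , r)
  dinv-shear {r} π = begin
    (pos (tdinv (m + n) n (b , reverse r)) ℤ.+ pos (pdinv (m + n) n b)) ℤ.- pos (maxdinv (m + n) n b)
      -- On the sheared path the maximum is attained by the unreversed labelling `r`, along which
      -- ranks still increase.
      ≡⟨ cong₂ (λ t x → (pos t ℤ.+ pos (pdinv (m + n) n b)) ℤ.- pos x)
           (tdinv-decreasing b (reverse r) path′ (Parking.permutes ρ) decreasing)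
           (maxdinv-attacks b r path′ (labelling-shear permutes) increasing′) ⟩
    pos (pdinv (m + n) n b) ℤ.- pos S
      ≡⟨ cong (λ p → pos p ℤ.- pos S) pdinv-shear ⟩
    pos (S + pdinv m n a) ℤ.- pos S
      ≡⟨ cancel S (pdinv m n a) ⟩
    pos (pdinv m n a)
      ≡⟨ cancel (tdinv m n (a , r)) (pdinv m n a) ⟨
    pos (tdinv m n (a , r) + pdinv m n a) ℤ.- pos (tdinv m n (a , r))
      ≡⟨ cong (λ x → pos (tdinv m n (a , r) + pdinv m n a) ℤ.- pos x)
           (trans (tdinv-increasing a r path permutes increasing) (sym (maxdinv-attacks a r path labelling increasing))) ⟩
    dinv m n (a , r) ∎
    where
    open Parking π hiding (path)
    open ≡-Reasoning
    ρ = parking-shear π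
    S = triangle n (attack (m + n) n B)
    increasing : ∀ {i j} → i < j → j < n → rank m n A (at r i 0) < rank m n A (at r j 0)
    increasing i<j j<n = outranked-reflects-< {m} {n} {A} (subst₂ _<_ (sym (position j<n)) (sym (position (<-trans i<j j<n)))
      (∸-monoʳ-< (s≤s i<j) j<n))
    increasing′ : ∀ {i j} → i < j → j < n → rank (m + n) n B (at r i 0) < rank (m + n) n B (at r j 0)
    increasing′ i<j j<n = <ᵇ⇒< _ _ (subst T (sym (rank-<ᵇ-shear (bounded (<-trans i<j j<n)) (bounded j<n)))
      (<⇒<ᵇ (increasing i<j j<n)))
    decreasing : ∀ {i j} → i < j → j < n →
                 rank (m + n) n B (at (reverse r) j 0) < rank (m + n) n B (at (reverse r) i 0)
    decreasing i<j j<n = outranked-reflects-< {m + n} {n} {B}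
      (subst₂ _<_ (sym (Parking.position ρ (<-trans i<j j<n))) (sym (Parking.position ρ j<n)) i<j)
    pdinv-shear : pdinv (m + n) n b ≡ S + pdinv m n a
    pdinv-shear = begin
      pdinv (m + n) n b                        ≡⟨ pdinv-hits b path′ ⟩
      triangle n (hits (m + n) n B)            ≡⟨ triangle-hits-shear path shear ⟩
      triangle n (hits m n A) + S              ≡⟨ +-comm (triangle n (hits m n A)) S ⟩
      S + triangle n (hits m n A)              ≡⟨ cong (S +_) (pdinv-hits a path) ⟨
      S + pdinv m n a                          ∎
    cancel : ∀ x y → pos (x + y) ℤ.- pos x ≡ pos y
    cancel x y = trans (ℤ.m-n≡m⊖n (x + y) x) (trans (ℤ.⊖-≥ (m≤m+n x y)) (cong pos (m+n∸m≡n x y)))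

-- Uniqueness of the labelling and strictly increasing columns

parking-unique : ∀ {m n} {b s t : Vec ℕ n} → Parking m n (b , s) id → Parking m n (b , t) id → s ≡ t
parking-unique {m} {n} {b} {s} {t} σ τ = at-ext λ {c} c<n →
  -- Car `i` of the second labelling shares its row with car `c` of the first; word positions depend
  -- on the row alone, hence `i` is `c`.
  let (i , i<n , eq) = surjective (Parking.permutes τ) (Parking.bounded σ c<n)
      i≡c = trans (sym (Parking.position τ i<n))
              (trans (cong (outranked m n (λ y → at b y 0)) eq) (Parking.position σ c<n))
  in trans (sym eq) (cong (λ z → at t z 0) i≡c)

-- Two cars in one column would appear in the word in the order opposite to their labels.
increasing-columns : ∀ {m n} .{{_ : NonZero m}} {b s : Vec ℕ n} → Parking m n (b , s) id →
                     ∀ {y} → suc y < n → at b y 0 < at b (suc y) 0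
increasing-columns {m} {n} {b} {s} ρ {y} 1+y<n with m≤n⇒m<n∨m≡n (Dyck.mono (Parking.path ρ) 1+y<n)
... | inj₁ lt = lt
... | inj₂ eq with surjective (Parking.permutes ρ) (<⇒≤ 1+y<n) | surjective (Parking.permutes ρ) 1+y<n
...   | i , i<n , si≡ | j , j<n , sj≡ with <-cmp i j
...     | tri≈ _ refl _ = ⊥-elim (1+n≢n (trans (sym sj≡) si≡))
...     | tri> _ _ j<i  = ⊥-elim (<-asym (n<1+n y) (subst₂ _<_ sj≡ si≡
            (Parking.column ρ j<i i<n (trans (cong B sj≡) (trans (sym eq) (cong B (sym si≡)))))))
            where B = λ z → at b z 0
...     | tri< i<j _ _  = ⊥-elim (<-asym
            (outranked-reflects-< {m} {n} {B} (subst₂ _<_ (at-row i<n si≡) (at-row j<n sj≡) i<j))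
            (rank-up (Parking.path ρ) (n<1+n y) 1+y<n
              (subst (λ x → m * y ∸ n * B y ≤ m * suc y ∸ n * x) eq (∸-monoˡ-≤ (n * B y) (*-monoʳ-≤ m (n≤1+n y))))))
            where
            B = λ z → at b z 0
            at-row : ∀ {i z} → i < n → at s i 0 ≡ z → i ≡ outranked m n B z
            at-row i<n eq = trans (sym (Parking.position ρ i<n)) (cong (outranked m n B) eq)

-- The staircase on paths and its inverse

raise : ∀ {n} → Vec ℕ n → Vec ℕ n
raise a = tabulate λ i → at a (toℕ i) 0 + toℕ i

-- For a path carrying the increasing word the truncated subtraction is exact: strictly increasing
-- columns force row `y` to start at column `y` or later.
lower : ∀ {n} → Vec ℕ n → Vec ℕ n
lower b = tabulate λ i → at b (toℕ i) 0 ∸ toℕ i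

at-raise : ∀ {n} (a : Vec ℕ n) {y} → y < n → at (raise a) y 0 ≡ at a y 0 + y
at-raise a = at-tabulate (λ y → at a y 0 + y)

raise-injective : ∀ {n} {a b : Vec ℕ n} → raise a ≡ raise b → a ≡ b
raise-injective {a = a} {b} eq = at-ext λ {y} y<n → +-cancelʳ-≡ y _ _
  (trans (sym (at-raise a y<n)) (trans (cong (λ v → at v y 0) eq) (at-raise b y<n)))

lam-raise : ∀ {n} (a : Vec ℕ n) → lam (raise a) ≡ staircase (lam a)
lam-raise {n} a = at-ext λ {i} i<n → begin
  at (reverse (raise a)) i 0               ≡⟨ at-reverse (raise a) i<n ⟩
  at (raise a) (n ∸ suc i) 0               ≡⟨ at-raise a (∸-flip-< i<n) ⟩
  at a (n ∸ suc i) 0 + (n ∸ suc i)         ≡⟨ cong₂ _+_ (at-reverse a i<n) (at-tabulate {n} (λ i → n ∸ suc i) i<n) ⟨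
  at (reverse a) i 0 + at (tabulate {n = n} (λ i → n ∸ suc (toℕ i))) i 0
                                           ≡⟨ at-zipWith-+ {n} (reverse a) _ i ⟨
  at (staircase (reverse a)) i 0           ∎
  where open ≡-Reasoning

module _ {m n : ℕ} .{{_ : NonZero m}} {b s : Vec ℕ n} (ρ : Parking (m + n) n (b , s) id) where
  private
    instance
      m+n≢0 : NonZero (m + n)
      m+n≢0 = >-nonZero (≤-trans (>-nonZero⁻¹ m) (m≤m+n m n))

    row≤column : ∀ {y} → y < n → y ≤ at b y 0
    row≤column {zero}  _     = z≤n
    row≤column {suc y} 1+y<n = ≤-<-trans (row≤column (<⇒≤ 1+y<n)) (increasing-columns ρ 1+y<n)

  at-lower : ∀ {y} → y < n → at b y 0 ≡ at (lower b) y 0 + y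
  at-lower {y} y<n = sym (trans (cong (_+ y) (at-tabulate (λ y → at b y 0 ∸ y) y<n)) (m∸n+n≡m (row≤column y<n)))

  raise-lower : raise (lower b) ≡ b
  raise-lower = at-ext λ y<n → trans (at-raise (lower b) y<n) (sym (at-lower y<n))

  -- The strict increase of the columns pays for the extra unit subtracted in row `suc y`, and the
  -- diagonal condition drops `n * y` on both sides.
  dyck-lower : Dyck m n (λ y → at (lower b) y 0)
  dyck-lower = record
    { mono  = λ {y} y< → +-cancelʳ-≤ (suc y) _ _ (subst₂ _≤_
        (trans (cong suc (at-lower (<⇒≤ y<))) (sym (+-suc _ y))) (at-lower y<) (increasing-columns ρ y<))
    ; above = λ {y} y<n → +-cancelʳ-≤ (n * y) _ _ (subst₂ _≤_
        (trans (cong (n *_) (at-lower y<n)) (*-distribˡ-+ n _ y)) (*-distribʳ-+ y m n) (Dyck.above (Parking.path ρ) y<n))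
    }

theorem8 : (m n : ℕ) → 0 < m → 0 < n →
    Σ (Raw n → Raw n) λ hstr →
    (∀ π → T (inA m n π) →
    T (inB (m + n) n (hstr π))
    × lam (proj₁ (hstr π)) ≡ staircase (lam (proj₁ π))
    × (∀ ρ → T (inB (m + n) n ρ) →
    lam (proj₁ ρ) ≡ staircase (lam (proj₁ π)) → ρ ≡ hstr π)
    × area (m + n) n (hstr π) ≡ area m n π
    × dinv (m + n) n (hstr π) ≡ dinv m n π
    × ret (m + n) n (hstr π) ≡ ret m n π)
    × (∀ π π′ → T (inA m n π) → T (inA m n π′) → hstr π ≡ hstr π′ → π ≡ π′)
    × (∀ ρ → T (inB (m + n) n ρ) → Σ (Raw n) λ π → T (inA m n π) × hstr π ≡ ρ)
theorem8 m n 0<m 0<n = hstr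
  , (λ π@(_ , r) t → let open Image π t in
        parking⁺ (hstr π) (incWord n) incWord-inv image
      , lam-raise a
      -- The partition determines the path because reversal is injective; the word then determines
      -- the labelling.
      , (λ ρ u eq → unique ρ (parking⁻ ρ (incWord n) incWord-inv u) (reverse-injective (trans eq (sym (lam-raise a)))))
      , area-shear {m} a (raise a) r (reverse r) (at-raise a)
      , dinv-shear park
      , ret-shear r (reverse r))
  , injective
  , onto
  where
  instance
    m≢0 : NonZero m
    m≢0 = >-nonZero 0<m
    m+n≢0 : NonZero (m + n)
    m+n≢0 = >-nonZero (≤-trans 0<m (m≤m+n m n))

  hstr : Raw n → Raw n
  hstr (a , r) = raise a , reverse r

  module Image (π : Raw n) (t : T (inA m n π)) where
    a = proj₁ π
    park : Parking m n π (λ c → n ∸ suc c)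
    park = parking⁻ π (decWord n) decWord-inv t
    open Shear a (raise a) (Parking.path park) (at-raise a) public
    image : Parking (m + n) n (hstr π) id
    image = parking-shear park
    unique : ∀ ρ → Parking (m + n) n ρ id → proj₁ ρ ≡ raise a → ρ ≡ hstr π
    unique (_ , s) σ refl = cong (raise a ,_) (parking-unique σ image)

  injective : ∀ π π′ → T (inA m n π) → T (inA m n π′) → hstr π ≡ hstr π′ → π ≡ π′
  injective π π′ _ _ eq = cong₂ _,_ (raise-injective (cong proj₁ eq)) (reverse-injective (cong proj₂ eq))

  onto : ∀ ρ → T (inB (m + n) n ρ) → Σ (Raw n) λ π → T (inA m n π) × hstr π ≡ ρ
  onto ρ@(b , s) t = (lower b , reverse s)
    , parking⁺ (lower b , reverse s) (decWord n) decWord-inv (parking-unshear park)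
    , cong₂ _,_ (raise-lower park) (reverse-involutive s)
    where
    park = parking⁻ ρ (incWord n) incWord-inv t
    open Shear (lower b) b (dyck-lower park) (at-lower park)
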